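{- Let $\Delta$ be a thin chamber complex of rank $n$. Every distance normal geodesic of $\Gamma_{n-1}(\Delta)$ is contained in the $(n-1)$-shadow of a certain zigzag of $\Delta$, and the following assertions hold: (1) if this geodesic is of length $m\le n$, then there are at most $(n-m)!$ zigzags whose $(n-1)$-shadows contain the geodesic; (2) if the length of the geodesic is greater than $n$, then it is contained in the $(n-1)$-shadow of a unique zigzag. (Zigzags are counted up to cyclic permutation and reversal, as explained in the context.)
   Context: A simplicial complex $\Delta$ over a finite set $V$ is a family of subsets of $V$ (faces), closed under taking subsets and containing all one-element subsets. A $k$-face is a face with $k+1$ elements; $\emptyset$ is the unique $(-1)$-face; facets are maximal faces. $\Delta$ is assumed pure: all facets have the same cardinality $n$, the rank. $\Delta$ is thin if every ridge ($(n-2)$-face) lies in precisely two distinct facets. Two facets are adjacent if their intersection is a ridge. $\Gamma_{n-1}(\Delta)$ is the graph whose vertices are the facets and whose edges are the pairs of adjacent facets; $\Delta$ is a chamber complex if this graph is connected. $d$ denotes the path distance in $\Gamma_{n-1}(\Delta)$, and a geodesic is a path joining two vertices whose length is their distance. Flags and zigzags: a flag is a maximal chain $X_0\subset X_1\subset\dots\subset X_{n-1}$ with $X_i$ an $i$-face. For a flag $F$ and $i\in\{0,\dots,n-1\}$ let $\sigma_i(F)$ be the unique flag differing from $F$ precisely in its $i$-face. Put $T(F)=\sigma_{n-1}\cdots\sigma_1\sigma_0(F)$ ($\sigma_0$ applied first). A zigzag is a (periodic) sequence $\{T^i(F)\}_{i\in\mathbb N}$, where $\mathbb N\ni 0$.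 Zigzags differing by a cyclic permutation (i.e. starting from $T^j(F)$ instead of $F$) are identified. If $F$ is the flag $\{x_0\}\subset\{x_0,x_1\}\subset\dots\subset\{x_0,\dots,x_{n-1}\}$, its reverse $R(F)$ is the flag $\{x_{n-1}\}\subset\{x_{n-1},x_{n-2}\}\subset\dots\subset\{x_{n-1},\dots,x_0\}$. The reverse of a zigzag $F_1,\dots,F_l$ (one period listed) is the zigzag $R(F_l),\dots,R(F_1)$; every zigzag is identified with its reverse. The $(n-1)$-shadow of a zigzag $\{F_i\}_{i\in\mathbb N}$ is the sequence of facets $\{Y_i\}_{i\in\mathbb N}$ with $Y_i$ the facet in $F_i$; it is a closed path in $\Gamma_{n-1}(\Delta)$. A path $X_0,\dots,X_m$ is contained in $\{Y_i\}$ if there is $j$ with $Y_{j+i}=X_i$ for all $i\in\{0,\dots,m\}$. Distance normality: facets $X,Y$ with $d(X,Y)\le n$ form a distance normal pair if $d(X,Y)=n-|X\cap Y|$; in this case every geodesic joining $X$ and $Y$ is called distance normal. If $d(X,Y)>n$, a geodesic $X=X_0,X_1,\dots,X_m=Y$ is called distance normal if any two $X_i,X_j$ with $d(X_i,X_j)\le n$ form a distance normal pair. -}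

module Defs where

open import Level using (0ℓ)
open import Data.Nat using (ℕ; suc; _+_; _∸_; _≤_; _<_; NonZero)
open import Data.Fin using (Fin; zero; suc; toℕ; fromℕ; inject₁; opposite)
import Data.Fin as Fin
open import Data.Fin.Subset using (Subset; _∈_; _⊆_; _⊂_; _∩_; ∣_∣; ⁅_⁆; ⊥)
open import Data.List using (List; length)
open import Data.List.Relation.Unary.Any using (Any)
open import Data.Product using (Σ; ∃-syntax; _×_)
open import Data.Sum using (_⊎_)
open import Data.Vec.Functional using (Vector)
open import Function using (_∘_; _⇔_)
open import Relation.Binary.Construct.Closure.Equivalence using (EqClosure)
open import Relation.Binary.PropositionalEquality using (_≡_; _≢_)
open import Relation.Unary using (Pred; Decidable)

-- The finite vertex set is Fin v.
record SimplicialComplex (v : ℕ) : Set₁ where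
  field
    Face        : Pred (Subset v) 0ℓ
    face?       : Decidable Face
    down-closed : ∀ {p q} → p ⊆ q → Face q → Face p
    singletons  : ∀ x → Face ⁅ x ⁆
    empty-face  : Face ⊥

  Facet : Pred (Subset v) 0ℓ
  Facet p = Face p × (∀ {q} → Face q → p ⊆ q → q ≡ p)

last : ∀ n → .{{NonZero n}} → Fin n
last (suc k) = fromℕ k

module _ {v : ℕ} (Δ : SimplicialComplex v) (n : ℕ) where

  open SimplicialComplex Δ

  Pure : Set
  Pure = ∀ {X} → Facet X → ∣ X ∣ ≡ n

  -- A k-face has k + 1 elements, so an (n - 2)-face has n - 1.
  Ridge : Pred (Subset v) 0ℓ
  Ridge r = Face r × suc ∣ r ∣ ≡ n

  Thin : Set
  Thin = ∀ {r} → Ridge r →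
    ∃[ X ] ∃[ Y ] (Facet X × r ⊆ X) × (Facet Y × r ⊆ Y) × X ≢ Y
      × (∀ {Z} → Facet Z → r ⊆ Z → Z ≡ X ⊎ Z ≡ Y)

  Adjacent : Subset v → Subset v → Set
  Adjacent X Y = Facet X × Facet Y × Ridge (X ∩ Y)

  -- A path of length m is listed by its m + 1 facets.
  IsPath : ∀ {m} → Vector (Subset v) (suc m) → Set
  IsPath {m} X =
    (∀ i → Facet (X i)) × (∀ (i : Fin m) → Adjacent (X (inject₁ i)) (X (suc i)))

  PathBetween : Subset v → Subset v → ℕ → Set
  PathBetween X Y m =
    Σ (Vector (Subset v) (suc m)) λ P → IsPath P × P zero ≡ X × P (fromℕ m) ≡ Y

  Connected : Set
  Connected = ∀ {X Y} → Facet X → Facet Y → ∃[ m ] PathBetween X Y m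

  record IsThinChamberComplex : Set where
    field
      pure      : Pure
      thin      : Thin
      connected : Connected

  -- The graph of the distance function: d(X , Y) = k.
  Distance : Subset v → Subset v → ℕ → Set
  Distance X Y k = PathBetween X Y k × (∀ {l} → PathBetween X Y l → k ≤ l)

  IsGeodesic : ∀ {m} → Vector (Subset v) (suc m) → Set
  IsGeodesic {m} X = IsPath X × Distance (X zero) (X (fromℕ m)) m

  DistanceNormalPair : Subset v → Subset v → Set
  DistanceNormalPair X Y = ∃[ k ] Distance X Y k × k ≤ n × k ≡ n ∸ ∣ X ∩ Y ∣

  IsDistanceNormalGeodesic : ∀ {m} → Vector (Subset v) (suc m) → Set
  IsDistanceNormalGeodesic {m} X =
    IsGeodesic X
      × (m ≤ n → DistanceNormalPair (X zero) (X (fromℕ m)))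
      × (n < m → ∀ i j {k} → Distance (X i) (X j) k → k ≤ n →
           DistanceNormalPair (X i) (X j))

  -- In a pure complex of rank n these are exactly the maximal chains of
  -- non-empty faces.
  record Flag : Set where
    field
      face    : Fin n → Subset v
      isFace  : ∀ i → Face (face i)
      size    : ∀ i → ∣ face i ∣ ≡ suc (toℕ i)
      strict  : ∀ {i j} → i Fin.< j → face i ⊂ face j

  open Flag public

  _≐_ : Flag → Flag → Set
  F ≐ G = ∀ i → face F i ≡ face G i

  -- G = σᵢ(F).
  IsSigma : Fin n → Flag → Flag → Set
  IsSigma i F G = face F i ≢ face G i × (∀ j → j ≢ i → face F j ≡ face G j)

  -- G = T(F) = σₙ₋₁ ⋯ σ₁ σ₀ (F), with the intermediate flags listed by H.
  IsT : Flag → Flag → Set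
  IsT F G = Σ (Vector Flag (suc n)) λ H →
    H zero ≐ F × (∀ i → IsSigma i (H (inject₁ i)) (H (suc i))) × H (fromℕ n) ≐ G

  -- The flag {x₀} ⊂ {x₀ , x₁} ⊂ ⋯ is F.
  Enumerates : Vector (Fin v) n → Flag → Set
  Enumerates x F = ∀ i y → y ∈ face F i ⇔ (∃[ j ] j Fin.≤ i × x j ≡ y)

  -- G = R(F).
  IsReverseFlag : Flag → Flag → Set
  IsReverseFlag F G = ∃[ x ] Enumerates x F × Enumerates (x ∘ opposite) G

  record Zigzag : Set where
    field
      flag : ℕ → Flag
      step : ∀ i → IsT (flag i) (flag (suc i))

  open Zigzag public

  Shift : Zigzag → Zigzag → Set
  Shift Z W = ∃[ j ] (∀ i → flag W i ≐ flag Z (j + i))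

  Period : Zigzag → ℕ → Set
  Period Z l = 0 < l × (∀ i → flag Z (l + i) ≐ flag Z i)

  -- Any period l gives the same reversed sequence up to a shift, so l need not
  -- be the least one.
  Reverse : Zigzag → Zigzag → Set
  Reverse Z W = ∃[ l ] Period Z l × Period W l
    × (∀ (i : Fin l) → IsReverseFlag (flag Z (toℕ (opposite i))) (flag W (toℕ i)))

  -- Identification of zigzags up to cyclic permutation and reversal.
  _≈_ : Zigzag → Zigzag → Set
  _≈_ = EqClosure λ Z W → Shift Z W ⊎ Reverse Z W

  shadow : .{{NonZero n}} → Zigzag → ℕ → Subset v
  shadow Z i = face (flag Z i) (last n)

  -- This concerns the given representative Z; a class of zigzags contains the
  -- path when some representative does.
  InShadow : .{{NonZero n}} → ∀ {m} → Vector (Subset v) (suc m) → Zigzag → Set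
  InShadow X Z = ∃[ j ] (∀ i → shadow Z (j + toℕ i) ≡ X i)

  -- At most k classes of zigzags have a representative satisfying P.
  AtMost : ℕ → Pred Zigzag 0ℓ → Set
  AtMost k P = Σ (List Zigzag) λ Zs →
    length Zs ≤ k × (∀ Z → P Z → Any (Z ≈_) Zs)

  ExactlyOne : Pred Zigzag 0ℓ → Set
  ExactlyOne P = ∃[ Z ] P Z × (∀ W → P W → W ≈ Z)

{-# OPTIONS --safe #-}
-- Listing a flag {x₀} ⊂ {x₀ , x₁} ⊂ ⋯ as the word x₀ ⋯ xₙ₋₁, T sends it to
-- x₁ ⋯ xₙ₋₁ xₙ, where the facet {x₁ , … , xₙ} is the other one through the ridge
-- {x₁ , … , xₙ₋₁}.  So step i of a zigzag discards exactly xᵢ from its facet.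
-- In a distance normal geodesic the vertices discarded in the first min(m , n)
-- steps are distinct and never return within n steps, hence any word of the
-- first facet that lists them in that order starts a zigzag following the
-- geodesic.  Conversely a zigzag following it must start with such a word, and
-- only the n ∸ m vertices that are never discarded can be ordered freely.

module Submission where

open import Defs
open import Data.Empty using (⊥-elim)
open import Data.Empty.Irrelevant renaming (⊥-elim to ⊥-elim-irr)
open import Data.Nat using (ℕ; zero; suc; _+_; _*_; _∸_; _⊓_; _≤_; _<_; _!; NonZero; ≢-nonZero⁻¹; z≤n; s≤s)
open import Data.Nat.Properties
open import Data.Fin using (Fin; zero; suc; toℕ; fromℕ; inject₁)
import Data.Fin as Fin
open import Data.Fin.Induction using (<-weakInduction)
open import Data.Fin.Properties using (any?; toℕ-fromℕ; toℕ-fromℕ<; toℕ-inject₁; toℕ<n; toℕ≤pred[n]; toℕ-injective)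
open import Data.Fin.Relation.Unary.Top using (view; ‵fromℕ; ‵inject₁)
open import Data.Fin.Subset using (Subset; inside; outside; _∈_; _∉_; _⊆_; _⊂_; _∩_; _∪_; _─_; ∣_∣; ⁅_⁆; ⊥)
open import Data.Fin.Subset.Properties
open import Data.List using (List; []; _∷_; _++_; _∷ʳ_; [_]; length; take; drop; map; concatMap)
open import Data.List.Membership.Propositional using (lose) renaming (_∈_ to _∈ˡ_)
open import Data.List.Membership.Propositional.Properties using (∈-map⁺; ∈-concatMap⁺; ∈-∃++)
open import Data.List.Membership.Propositional.Properties.WithK using (unique∧set⇒bag)
open import Data.List.Properties using (length-take; length-drop; length-++; length-map; take++drop≡id; take-all; ∷-injective)
open import Data.List.Relation.Binary.BagAndSetEquality using (∼bag⇒↭)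
open import Data.List.Relation.Binary.Permutation.Propositional using (_↭_; ↭-sym)
open import Data.List.Relation.Binary.Permutation.Propositional.Properties using (drop-∷; drop-mid; ∈-resp-↭; ↭-empty-inv)
open import Data.List.Relation.Unary.All as All using (All; []; _∷_)
import Data.List.Relation.Unary.All.Properties as All
open import Data.List.Relation.Unary.AllPairs using ([]; _∷_)
open import Data.List.Relation.Unary.Any using (Any; here; there)
open import Data.List.Relation.Unary.Unique.Propositional using (Unique)
open import Data.Product using (_×_; _,_; proj₁; proj₂; ∃-syntax)
open import Data.Sum using (_⊎_; inj₁; inj₂; [_,_]′)
open import Data.Vec using ([]; _∷_)
open import Data.Vec.Functional using (Vector)
open import Function using (_∘_; mk⇔)
open import Relation.Binary.Construct.Closure.Equivalence using (return; symmetric; transitive)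
open import Relation.Binary.PropositionalEquality hiding ([_])
open import Relation.Nullary using (¬_; yes; no; ¬?; _×-dec_; contradiction)

-- Distance normality is used in the form `∣ X i ─ X (i + d) ∣ ≡ d` for `d ≤ n`, a condition on the
-- vertices lost between two facets of the path. For m > n it is the hypothesis on pairs, because
-- subpaths of a geodesic are geodesics. For m ≤ n only the end pair is given as normal, and the
-- triangle inequality for `∣ p ─ q ∣` spreads this to all pairs. The bound `d ≤ n` is forced, since
-- a facet has only n vertices to lose. A long path therefore cannot be controlled by its first word
-- alone: the word is renewed at each step, and the loss of all n vertices supplies the condition on
-- its new last letter. The new vertex is never a choice: thinness leaves one other facet through a
-- ridge, so zigzags that agree in one flag agree from there on. Counting classes is thus counting
-- the words with which zigzags enter the path, all compared with one reference word. As subtraction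
-- is truncated, `(n ∸ m) !` is 0! = 1 for m > n, and uniqueness is existence together with the
-- bound.

private variable
  v : ℕ
  p q r : Subset v

-- Cardinalities of unions and differences of finite subsets

∣p∪q∣+∣p∩q∣≡∣p∣+∣q∣ : (p q : Subset v) → ∣ p ∪ q ∣ + ∣ p ∩ q ∣ ≡ ∣ p ∣ + ∣ q ∣
∣p∪q∣+∣p∩q∣≡∣p∣+∣q∣ [] [] = refl
∣p∪q∣+∣p∩q∣≡∣p∣+∣q∣ (outside ∷ p) (outside ∷ q) = ∣p∪q∣+∣p∩q∣≡∣p∣+∣q∣ p q
∣p∪q∣+∣p∩q∣≡∣p∣+∣q∣ (outside ∷ p) (inside  ∷ q) =
  trans (cong suc (∣p∪q∣+∣p∩q∣≡∣p∣+∣q∣ p q)) (sym (+-suc ∣ p ∣ ∣ q ∣))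
∣p∪q∣+∣p∩q∣≡∣p∣+∣q∣ (inside  ∷ p) (outside ∷ q) = cong suc (∣p∪q∣+∣p∩q∣≡∣p∣+∣q∣ p q)
∣p∪q∣+∣p∩q∣≡∣p∣+∣q∣ (inside  ∷ p) (inside  ∷ q) = cong suc (trans (+-suc ∣ p ∪ q ∣ ∣ p ∩ q ∣)
  (trans (cong suc (∣p∪q∣+∣p∩q∣≡∣p∣+∣q∣ p q)) (sym (+-suc ∣ p ∣ ∣ q ∣))))

∣p∩q∣+∣p─q∣≡∣p∣ : (p q : Subset v) → ∣ p ∩ q ∣ + ∣ p ─ q ∣ ≡ ∣ p ∣
∣p∩q∣+∣p─q∣≡∣p∣ [] [] = refl
∣p∩q∣+∣p─q∣≡∣p∣ (outside ∷ p) (outside ∷ q) = ∣p∩q∣+∣p─q∣≡∣p∣ p q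
∣p∩q∣+∣p─q∣≡∣p∣ (outside ∷ p) (inside  ∷ q) = ∣p∩q∣+∣p─q∣≡∣p∣ p q
∣p∩q∣+∣p─q∣≡∣p∣ (inside  ∷ p) (outside ∷ q) =
  trans (+-suc ∣ p ∩ q ∣ ∣ p ─ q ∣) (cong suc (∣p∩q∣+∣p─q∣≡∣p∣ p q))
∣p∩q∣+∣p─q∣≡∣p∣ (inside  ∷ p) (inside  ∷ q) = cong suc (∣p∩q∣+∣p─q∣≡∣p∣ p q)

∣p∪q∣≤∣p∣+∣q∣ : (p q : Subset v) → ∣ p ∪ q ∣ ≤ ∣ p ∣ + ∣ q ∣
∣p∪q∣≤∣p∣+∣q∣ p q = ≤-trans (m≤m+n ∣ p ∪ q ∣ ∣ p ∩ q ∣) (≤-reflexive (∣p∪q∣+∣p∩q∣≡∣p∣+∣q∣ p q))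

x∈p─q⇒x∉q : (p q : Subset v) {x : Fin v} → x ∈ p ─ q → x ∉ q
x∈p─q⇒x∉q (_ ∷ p) (outside ∷ q) {zero} _ ()
x∈p─q⇒x∉q (_ ∷ p) (inside  ∷ q) {zero} ()
x∈p─q⇒x∉q (_ ∷ p) (_ ∷ q) {suc x} x∈ = x∈p─q⇒x∉q p q (drop-there x∈) ∘ drop-there

p─r⊆p─q∪q─r : (p q r : Subset v) → p ─ r ⊆ (p ─ q) ∪ (q ─ r)
p─r⊆p─q∪q─r p q r {x} x∈ with x ∈? q
... | yes x∈q = x∈p∪q⁺ (inj₂ (x∈p∧x∉q⇒x∈p─q x∈q (x∈p─q⇒x∉q p r x∈)))
... | no  x∉q = x∈p∪q⁺ (inj₁ (x∈p∧x∉q⇒x∈p─q (p─q⊆p p r x∈) x∉q))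

∣p─r∣≤∣p─q∣+∣q─r∣ : (p q r : Subset v) → ∣ p ─ r ∣ ≤ ∣ p ─ q ∣ + ∣ q ─ r ∣
∣p─r∣≤∣p─q∣+∣q─r∣ p q r =
  ≤-trans (p⊆q⇒∣p∣≤∣q∣ (p─r⊆p─q∪q─r p q r)) (∣p∪q∣≤∣p∣+∣q∣ (p ─ q) (q ─ r))

⊈⇒∃ : (p q : Subset v) → ¬ p ⊆ q → ∃[ x ] x ∈ p × x ∉ q
⊈⇒∃ p q p⊈q with any? (λ x → (x ∈? p) ×-dec ¬? (x ∈? q))
... | yes found = found
... | no  none  = ⊥-elim (p⊈q p⊆q)
  where
  p⊆q : p ⊆ q
  p⊆q {x} x∈p with x ∈? q
  ... | yes x∈q = x∈q
  ... | no  x∉q = contradiction (x , x∈p , x∉q) none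

⊆∧∣q∣≤∣p∣⇒≡ : p ⊆ q → ∣ q ∣ ≤ ∣ p ∣ → p ≡ q
⊆∧∣q∣≤∣p∣⇒≡ {p = p} {q} p⊆q ∣q∣≤∣p∣ with q ⊆? p
... | yes q⊆p = ⊆-antisym p⊆q q⊆p
... | no  q⊈p = contradiction ∣q∣≤∣p∣ (<⇒≱ (p⊂q⇒∣p∣<∣q∣ (p⊆q , ⊈⇒∃ q p q⊈p)))

∣p∣<∣q∣⇒∃ : (p q : Subset v) → ∣ p ∣ < ∣ q ∣ → ∃[ x ] x ∈ q × x ∉ p
∣p∣<∣q∣⇒∃ p q ∣p∣<∣q∣ = ⊈⇒∃ q p λ q⊆p → <⇒≱ ∣p∣<∣q∣ (p⊆q⇒∣p∣≤∣q∣ q⊆p)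

p≢q⇒∃ : (p q : Subset v) → ∣ p ∣ ≡ ∣ q ∣ → p ≢ q → ∃[ x ] x ∈ q × x ∉ p
p≢q⇒∃ p q eq p≢q = ⊈⇒∃ q p λ q⊆p → p≢q (sym (⊆∧∣q∣≤∣p∣⇒≡ q⊆p (≤-reflexive eq)))

⁅x⁆⊆p : ∀ {x : Fin v} → x ∈ p → ⁅ x ⁆ ⊆ p
⁅x⁆⊆p {p = p} {x} x∈p y∈ = subst (_∈ p) (sym (x∈⁅y⁆⇒x≡y x y∈)) x∈p

∪-lub : p ⊆ r → q ⊆ r → p ∪ q ⊆ r
∪-lub {p = p} {q = q} p⊆r q⊆r = [ p⊆r , q⊆r ]′ ∘ x∈p∪q⁻ p q

∣⁅x⁆∪p∣≤ : ∀ (x : Fin v) p → ∣ ⁅ x ⁆ ∪ p ∣ ≤ suc ∣ p ∣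
∣⁅x⁆∪p∣≤ x p = ≤-trans (∣p∪q∣≤∣p∣+∣q∣ ⁅ x ⁆ p) (≤-reflexive (cong (_+ ∣ p ∣) (∣⁅x⁆∣≡1 x)))

x∉p⇒∣⁅x⁆∪p∣ : ∀ {x : Fin v} → x ∉ p → suc ∣ p ∣ ≤ ∣ ⁅ x ⁆ ∪ p ∣
x∉p⇒∣⁅x⁆∪p∣ {p = p} {x} x∉p =
  p⊂q⇒∣p∣<∣q∣ (q⊆p∪q ⁅ x ⁆ p , x , p⊆p∪q p (x∈⁅x⁆ x) , x∉p)

⁅x⁆∪p≡q : ∀ {x : Fin v} → p ⊆ q → ∣ q ∣ ≡ suc ∣ p ∣ → x ∈ q → x ∉ p → ⁅ x ⁆ ∪ p ≡ q
⁅x⁆∪p≡q p⊆q eq x∈q x∉p =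
  ⊆∧∣q∣≤∣p∣⇒≡ (∪-lub (⁅x⁆⊆p x∈q) p⊆q) (≤-trans (≤-reflexive eq) (x∉p⇒∣⁅x⁆∪p∣ x∉p))

-- Adding to `p` the vertex that `q` has outside it already gives all of `b`. So `b` has a single
-- vertex outside `p`, and `q` and `q′` both consist of `a` and this vertex.
diamond : ∀ {a b p q q′ : Subset v} → a ⊆ p → a ⊆ q → a ⊆ q′ → p ⊆ b → q ⊆ b → q′ ⊆ b →
  ∣ p ∣ ≡ suc ∣ a ∣ → ∣ q ∣ ≡ suc ∣ a ∣ → ∣ q′ ∣ ≡ suc ∣ a ∣ → ∣ b ∣ ≡ suc ∣ p ∣ →
  p ≢ q → p ≢ q′ → q ≡ q′
diamond {a = a} {b} {p} {q} {q′} a⊆p a⊆q a⊆q′ p⊆b q⊆b q′⊆b ∣p∣ ∣q∣ ∣q′∣ ∣b∣ p≢q p≢q′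
  with p≢q⇒∃ p q (trans ∣p∣ (sym ∣q∣)) p≢q | p≢q⇒∃ p q′ (trans ∣p∣ (sym ∣q′∣)) p≢q′
... | x , x∈q , x∉p | y , y∈q′ , y∉p = begin
  q          ≡⟨ ⁅x⁆∪p≡q a⊆q ∣q∣ x∈q (x∉p ∘ a⊆p) ⟨
  ⁅ x ⁆ ∪ a  ≡⟨ cong (λ z → ⁅ z ⁆ ∪ a) (sym y≡x) ⟩
  ⁅ y ⁆ ∪ a  ≡⟨ ⁅x⁆∪p≡q a⊆q′ ∣q′∣ y∈q′ (y∉p ∘ a⊆p) ⟩
  q′         ∎
  where
  open ≡-Reasoning
  y≡x : y ≡ x
  y≡x with x∈p∪q⁻ ⁅ x ⁆ p (subst (y ∈_) (sym (⁅x⁆∪p≡q p⊆b ∣b∣ (q⊆b x∈q) x∉p)) (q′⊆b y∈q′))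
  ... | inj₁ y∈⁅x⁆ = x∈⁅y⁆⇒x≡y x y∈⁅x⁆
  ... | inj₂ y∈p   = contradiction y∈p y∉p

-- Words and the sets of their letters

⟦_⟧ : List (Fin v) → Subset v
⟦ [] ⟧     = ⊥
⟦ x ∷ xs ⟧ = ⁅ x ⁆ ∪ ⟦ xs ⟧

x∈⟦x∷xs⟧ : ∀ (x : Fin v) xs → x ∈ ⟦ x ∷ xs ⟧
x∈⟦x∷xs⟧ x xs = p⊆p∪q ⟦ xs ⟧ (x∈⁅x⁆ x)

⟦xs⟧⊆⟦x∷xs⟧ : ∀ (x : Fin v) xs → ⟦ xs ⟧ ⊆ ⟦ x ∷ xs ⟧
⟦xs⟧⊆⟦x∷xs⟧ x xs = q⊆p∪q ⁅ x ⁆ ⟦ xs ⟧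

⟦++⟧ : ∀ (xs ys : List (Fin v)) → ⟦ xs ++ ys ⟧ ≡ ⟦ xs ⟧ ∪ ⟦ ys ⟧
⟦++⟧ []       ys = sym (∪-identityˡ ⟦ ys ⟧)
⟦++⟧ (x ∷ xs) ys = trans (cong (⁅ x ⁆ ∪_) (⟦++⟧ xs ys)) (sym (∪-assoc ⁅ x ⁆ ⟦ xs ⟧ ⟦ ys ⟧))

⟦∷ʳ⟧ : ∀ (xs : List (Fin v)) x → ⟦ xs ∷ʳ x ⟧ ≡ ⁅ x ⁆ ∪ ⟦ xs ⟧
⟦∷ʳ⟧ xs x = trans (⟦++⟧ xs [ x ]) (trans (∪-comm ⟦ xs ⟧ ⟦ [ x ] ⟧) (cong (_∪ ⟦ xs ⟧) (∪-identityʳ ⁅ x ⁆)))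

∣⟦xs⟧∣≤length : ∀ (xs : List (Fin v)) → ∣ ⟦ xs ⟧ ∣ ≤ length xs
∣⟦xs⟧∣≤length {v} []   = ≤-reflexive (∣⊥∣≡0 v)
∣⟦xs⟧∣≤length (x ∷ xs) = ≤-trans (∣⁅x⁆∪p∣≤ x ⟦ xs ⟧) (s≤s (∣⟦xs⟧∣≤length xs))

-- Neither part of the word can have more distinct letters than its length, and together they must
-- reach the full length; so both bounds are attained.
∣⟦take⟧∣ : ∀ j (xs : List (Fin v)) → ∣ ⟦ xs ⟧ ∣ ≡ length xs → j ≤ length xs →
  ∣ ⟦ take j xs ⟧ ∣ ≡ j
∣⟦take⟧∣ j xs card j≤ = ≤-antisym
  (≤-trans (∣⟦xs⟧∣≤length (take j xs)) (≤-reflexive length-take-j))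
  (+-cancelʳ-≤ (length (drop j xs)) j ∣ ⟦ take j xs ⟧ ∣ (begin
    j + length (drop j xs)                        ≡⟨ cong (_+ length (drop j xs)) length-take-j ⟨
    length (take j xs) + length (drop j xs)       ≡⟨ length-++ (take j xs) ⟨
    length (take j xs ++ drop j xs)               ≡⟨ cong length (take++drop≡id j xs) ⟩
    length xs                                     ≡⟨ card ⟨
    ∣ ⟦ xs ⟧ ∣                                    ≡⟨ cong (∣_∣ ∘ ⟦_⟧) (take++drop≡id j xs) ⟨
    ∣ ⟦ take j xs ++ drop j xs ⟧ ∣                ≡⟨ cong ∣_∣ (⟦++⟧ (take j xs) (drop j xs)) ⟩
    ∣ ⟦ take j xs ⟧ ∪ ⟦ drop j xs ⟧ ∣             ≤⟨ ∣p∪q∣≤∣p∣+∣q∣ ⟦ take j xs ⟧ ⟦ drop j xs ⟧ ⟩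
    ∣ ⟦ take j xs ⟧ ∣ + ∣ ⟦ drop j xs ⟧ ∣         ≤⟨ +-monoʳ-≤ _ (∣⟦xs⟧∣≤length (drop j xs)) ⟩
    ∣ ⟦ take j xs ⟧ ∣ + length (drop j xs)        ∎))
  where
  open ≤-Reasoning
  length-take-j : length (take j xs) ≡ j
  length-take-j = trans (length-take j xs) (m≤n⇒m⊓n≡m j≤)

⟦take⟧-mono : ∀ {i j} (xs : List (Fin v)) → i ≤ j → ⟦ take i xs ⟧ ⊆ ⟦ take j xs ⟧
⟦take⟧-mono xs       z≤n       = ⊥⊆
⟦take⟧-mono []       (s≤s i≤j) = ⊆-refl
⟦take⟧-mono (x ∷ xs) (s≤s i≤j) =
  ∪-lub (p⊆p∪q _) (q⊆p∪q ⁅ x ⁆ _ ∘ ⟦take⟧-mono xs i≤j)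

⟦take⟧⊆ : ∀ j (xs : List (Fin v)) → ⟦ take j xs ⟧ ⊆ ⟦ xs ⟧
⟦take⟧⊆ zero    xs       = ⊥⊆
⟦take⟧⊆ (suc j) []       = ⊆-refl
⟦take⟧⊆ (suc j) (x ∷ xs) = ∪-lub (p⊆p∪q ⟦ xs ⟧) (q⊆p∪q ⁅ x ⁆ _ ∘ ⟦take⟧⊆ j xs)

∣⟦x∷xs⟧∣-tail : ∀ (x : Fin v) xs → ∣ ⟦ x ∷ xs ⟧ ∣ ≡ suc (length xs) →
  x ∉ ⟦ xs ⟧ × ∣ ⟦ xs ⟧ ∣ ≡ length xs
∣⟦x∷xs⟧∣-tail x xs card = x∉ , ≤-antisym (∣⟦xs⟧∣≤length xs)
  (≤-pred (≤-trans (≤-reflexive (sym card)) (∣⁅x⁆∪p∣≤ x ⟦ xs ⟧)))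
  where
  x∉ : x ∉ ⟦ xs ⟧
  x∉ x∈ = <⇒≱ (≤-reflexive (sym card))
    (≤-trans (p⊆q⇒∣p∣≤∣q∣ (∪-lub (⁅x⁆⊆p x∈) ⊆-refl)) (∣⟦xs⟧∣≤length xs))

∈⇒∈⟦⟧ : ∀ {x : Fin v} {xs} → x ∈ˡ xs → x ∈ ⟦ xs ⟧
∈⇒∈⟦⟧ {xs = x ∷ xs} (here refl) = x∈⟦x∷xs⟧ x xs
∈⇒∈⟦⟧ {xs = x ∷ xs} (there y∈)  = ⟦xs⟧⊆⟦x∷xs⟧ x xs (∈⇒∈⟦⟧ y∈)

∈⟦⟧⇒∈ : ∀ {x : Fin v} xs → x ∈ ⟦ xs ⟧ → x ∈ˡ xs
∈⟦⟧⇒∈ []       x∈ = contradiction x∈ ∉⊥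
∈⟦⟧⇒∈ (y ∷ xs) x∈ with x∈p∪q⁻ ⁅ y ⁆ ⟦ xs ⟧ x∈
... | inj₁ x∈⁅y⁆ = here (x∈⁅y⁆⇒x≡y y x∈⁅y⁆)
... | inj₂ x∈xs  = there (∈⟦⟧⇒∈ xs x∈xs)

∣⟦xs⟧∣≡length⇒Unique : ∀ (xs : List (Fin v)) → ∣ ⟦ xs ⟧ ∣ ≡ length xs → Unique xs
∣⟦xs⟧∣≡length⇒Unique []       card = []
∣⟦xs⟧∣≡length⇒Unique (x ∷ xs) card with ∣⟦x∷xs⟧∣-tail x xs card
... | x∉ , card′ =
  All.tabulate (λ y∈ x≡y → x∉ (∈⇒∈⟦⟧ (subst (_∈ˡ xs) (sym x≡y) y∈))) ∷ ∣⟦xs⟧∣≡length⇒Unique xs card′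

⟦⟧≡⇒↭ : ∀ (xs ys : List (Fin v)) → ∣ ⟦ xs ⟧ ∣ ≡ length xs → ∣ ⟦ ys ⟧ ∣ ≡ length ys →
  ⟦ xs ⟧ ≡ ⟦ ys ⟧ → xs ↭ ys
⟦⟧≡⇒↭ xs ys cx cy eq = ∼bag⇒↭
  (unique∧set⇒bag (∣⟦xs⟧∣≡length⇒Unique xs cx) (∣⟦xs⟧∣≡length⇒Unique ys cy)
    (mk⇔ (∈⟦⟧⇒∈ ys ∘ subst (_ ∈_) eq ∘ ∈⇒∈⟦⟧) (∈⟦⟧⇒∈ xs ∘ subst (_ ∈_) (sym eq) ∘ ∈⇒∈⟦⟧)))

-- Enumerating the rearrangements of a list

module _ {A : Set} where

  ++-cancelˡ-↭ : ∀ (xs : List A) {ys zs} → xs ++ ys ↭ xs ++ zs → ys ↭ zs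
  ++-cancelˡ-↭ []       eq = eq
  ++-cancelˡ-↭ (x ∷ xs) eq = ++-cancelˡ-↭ xs (drop-∷ eq)

  insertions : A → List A → List (List A)
  insertions x []       = [ [ x ] ]
  insertions x (y ∷ ys) = (x ∷ y ∷ ys) ∷ map (y ∷_) (insertions x ys)

  length-insertions : ∀ x ys → length (insertions x ys) ≡ suc (length ys)
  length-insertions x []       = refl
  length-insertions x (y ∷ ys) =
    cong suc (trans (length-map (y ∷_) (insertions x ys)) (length-insertions x ys))

  ∈-insertions : ∀ x ys zs → ys ++ x ∷ zs ∈ˡ insertions x (ys ++ zs)
  ∈-insertions x []       []       = here refl
  ∈-insertions x []       (z ∷ zs) = here refl
  ∈-insertions x (y ∷ ys) zs       = there (∈-map⁺ (y ∷_) (∈-insertions x ys zs))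

  -- Repeated entries would do no harm: the length serves only as an upper bound for a number of
  -- classes.
  orders : List A → List (List A)
  orders []       = [ [] ]
  orders (x ∷ xs) = concatMap (insertions x) (orders xs)

  ∈-orders : ∀ xs {ys} → ys ↭ xs → ys ∈ˡ orders xs
  ∈-orders []       ys↭ with refl ← ↭-empty-inv ys↭ = here refl
  ∈-orders (x ∷ xs) ys↭
    with ps , qs , refl ← ∈-∃++ (∈-resp-↭ (↭-sym ys↭) (here refl)) =
    ∈-concatMap⁺ (insertions x) (lose (∈-orders xs (drop-mid ps [] ys↭)) (∈-insertions x ps qs))

  insertions-lengths : ∀ x ys → All (λ zs → length zs ≡ suc (length ys)) (insertions x ys)
  insertions-lengths x []       = refl ∷ []
  insertions-lengths x (y ∷ ys) = refl ∷ All.map⁺ (All.map (cong suc) (insertions-lengths x ys))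

  orders-lengths : ∀ xs → All (λ ys → length ys ≡ length xs) (orders xs)
  orders-lengths []       = refl ∷ []
  orders-lengths (x ∷ xs) = All.concat⁺ (All.map⁺ (All.map insert-x (orders-lengths xs)))
    where
    insert-x : ∀ {ys} → length ys ≡ length xs →
      All (λ zs → length zs ≡ suc (length xs)) (insertions x ys)
    insert-x {ys} eq = All.map (λ eq′ → trans eq′ (cong suc eq)) (insertions-lengths x ys)

  length-orders : ∀ xs → length (orders xs) ≡ length xs !
  length-orders []       = refl
  length-orders (x ∷ xs) = begin
    length (concatMap (insertions x) (orders xs))  ≡⟨ count (orders-lengths xs) ⟩
    length (orders xs) * suc (length xs)           ≡⟨ *-comm (length (orders xs)) (suc (length xs)) ⟩
    suc (length xs) * length (orders xs)           ≡⟨ cong (suc (length xs) *_) (length-orders xs) ⟩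
    suc (length xs) * length xs !                  ∎
    where
    open ≡-Reasoning
    count : ∀ {yss} → All (λ ys → length ys ≡ length xs) yss →
      length (concatMap (insertions x) yss) ≡ length yss * suc (length xs)
    count []                  = refl
    count (_∷_ {x = ys} eq eqs) = trans (length-++ (insertions x ys))
      (cong₂ _+_ (trans (length-insertions x ys) (cong suc eq)) (count eqs))

-- Words that fill the gaps in a chain of subsets

interpolate : ∀ {p q : Subset v} d → p ⊆ q → ∣ p ∣ + d ≡ ∣ q ∣ →
  ∃[ xs ] length xs ≡ d × p ∪ ⟦ xs ⟧ ≡ q
interpolate {p = p} zero p⊆q eq = [] , refl , trans (∪-identityʳ p)
  (⊆∧∣q∣≤∣p∣⇒≡ p⊆q (≤-reflexive (trans (sym eq) (+-identityʳ ∣ p ∣))))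
interpolate {p = p} {q} (suc d) p⊆q eq
  with ∣p∣<∣q∣⇒∃ p q (≤-trans (m≤m+n (suc ∣ p ∣) d) (≤-reflexive (trans (sym (+-suc ∣ p ∣ d)) eq)))
... | x , x∈q , x∉p
  with interpolate {p = p ∪ ⁅ x ⁆} d (∪-lub p⊆q (⁅x⁆⊆p x∈q)) (begin
    ∣ p ∪ ⁅ x ⁆ ∣ + d  ≡⟨ cong (λ s → ∣ s ∣ + d) (∪-comm p ⁅ x ⁆) ⟩
    ∣ ⁅ x ⁆ ∪ p ∣ + d  ≡⟨ cong (_+ d) (≤-antisym (∣⁅x⁆∪p∣≤ x p) (x∉p⇒∣⁅x⁆∪p∣ x∉p)) ⟩
    suc ∣ p ∣ + d      ≡⟨ +-suc ∣ p ∣ d ⟨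
    ∣ p ∣ + suc d      ≡⟨ eq ⟩
    ∣ q ∣              ∎)
  where open ≡-Reasoning
... | xs , len , eq′ = x ∷ xs , cong suc len , trans (sym (∪-assoc p ⁅ x ⁆ ⟦ xs ⟧)) eq′

-- Used twice: for the faces of a flag, and for the growing sets of vertices that a path has
-- discarded.
chain⇒word : ∀ {m} (p : Fin (suc m) → Subset v) →
  (∀ i → p (inject₁ i) ⊆ p (suc i)) → (∀ i → ∣ p (suc i) ∣ ≡ suc ∣ p (inject₁ i) ∣) →
  ∃[ xs ] length xs ≡ m × (∀ i → p zero ∪ ⟦ take (toℕ i) xs ⟧ ≡ p i)
chain⇒word {m = zero}  p mono card = [] , refl , λ { zero → ∪-identityʳ (p zero) }
chain⇒word {m = suc m} p mono card
  with ∣p∣<∣q∣⇒∃ (p zero) (p (suc zero)) (≤-reflexive (sym (card zero)))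
     | chain⇒word (p ∘ suc) (mono ∘ suc) (card ∘ suc)
... | x , x∈ , x∉ | xs , len , eq = x ∷ xs , cong suc len , prefixes
  where
  open ≡-Reasoning
  prefixes : ∀ i → p zero ∪ ⟦ take (toℕ i) (x ∷ xs) ⟧ ≡ p i
  prefixes zero    = ∪-identityʳ (p zero)
  prefixes (suc i) = begin
    p zero ∪ (⁅ x ⁆ ∪ ⟦ take (toℕ i) xs ⟧)  ≡⟨ ∪-assoc (p zero) ⁅ x ⁆ _ ⟨
    (p zero ∪ ⁅ x ⁆) ∪ ⟦ take (toℕ i) xs ⟧  ≡⟨ cong (_∪ _) (∪-comm (p zero) ⁅ x ⁆) ⟩
    (⁅ x ⁆ ∪ p zero) ∪ ⟦ take (toℕ i) xs ⟧  ≡⟨ cong (_∪ _) (⁅x⁆∪p≡q (mono zero) (card zero) x∈ x∉) ⟩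
    p (suc zero) ∪ ⟦ take (toℕ i) xs ⟧      ≡⟨ eq i ⟩
    p (suc i)                               ∎

take-++ : ∀ {A : Set} j (xs ys : List A) → j ≤ length xs → take j (xs ++ ys) ≡ take j xs
take-++ zero    xs       ys j≤       = refl
take-++ (suc j) (x ∷ xs) ys (s≤s j≤) = cong (x ∷_) (take-++ j xs ys j≤)

-- When `j` exceeds the common length, the hypothesis also compares the last letters; this is simply
-- forgotten, which leaves `j` unbounded.
take-∷ʳ-injective : ∀ {A : Set} j (xs ys : List A) {x y} → length xs ≡ length ys →
  take j (xs ∷ʳ x) ≡ take j (ys ∷ʳ y) → take j xs ≡ take j ys
take-∷ʳ-injective j       []       []       len eq = refl
take-∷ʳ-injective zero    (_ ∷ xs) (_ ∷ ys) len eq = refl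
take-∷ʳ-injective (suc j) (_ ∷ xs) (_ ∷ ys) len eq with ∷-injective eq
... | refl , eq′ = cong (_ ∷_) (take-∷ʳ-injective j xs ys (suc-injective len) eq′)

∣p─q∣≡1⇒unique : ∀ {x y : Fin v} → ∣ p ─ q ∣ ≡ 1 → x ∈ p → x ∉ q → y ∈ p → y ∉ q → y ≡ x
∣p─q∣≡1⇒unique {p = p} {q} {x} {y} card x∈p x∉q y∈p y∉q =
  x∈⁅y⁆⇒x≡y x (subst (y ∈_) (sym ⁅x⁆≡) (x∈p∧x∉q⇒x∈p─q y∈p y∉q))
  where
  ⁅x⁆≡ : ⁅ x ⁆ ≡ p ─ q
  ⁅x⁆≡ = ⊆∧∣q∣≤∣p∣⇒≡ (⁅x⁆⊆p (x∈p∧x∉q⇒x∈p─q x∈p x∉q))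
    (≤-reflexive (trans card (sym (∣⁅x⁆∣≡1 x))))

-- The recursion along a path drops its first facet again and again. Repeating the last facet for
-- ever turns the path into a sequence on ℕ, where this is composition with `suc`.
clamp : ∀ m → ℕ → Fin (suc m)
clamp m       zero    = zero
clamp zero    (suc l) = zero
clamp (suc m) (suc l) = suc (clamp m l)

toℕ-clamp : ∀ {m l} → l ≤ m → toℕ (clamp m l) ≡ l
toℕ-clamp z≤n       = refl
toℕ-clamp (s≤s l≤m) = cong suc (toℕ-clamp l≤m)

clamp-toℕ : ∀ {m} (i : Fin (suc m)) → clamp m (toℕ i) ≡ i
clamp-toℕ         zero    = refl
clamp-toℕ {suc m} (suc i) = cong suc (clamp-toℕ i)

clamp-step : ∀ {A : Set} (_~_ : A → A → Set) {m} (X : Vector A (suc m)) →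
  (∀ (i : Fin m) → X (inject₁ i) ~ X (suc i)) → ∀ l → l < m → X (clamp m l) ~ X (clamp m (suc l))
clamp-step _~_ {suc m} X step zero    l<m       = step zero
clamp-step _~_ {suc m} X step (suc l) (s≤s l<m) = clamp-step _~_ (X ∘ suc) (step ∘ suc) l l<m

-- Moves x through the word x ∷ xs one place at a time and finally replaces it
-- by y: these are the flags between F and T(F).
rotate : ℕ → Fin v → List (Fin v) → Fin v → List (Fin v)
rotate zero    x xs       y = x ∷ xs
rotate (suc i) x []       y = [ y ]
rotate (suc i) x (z ∷ xs) y = z ∷ rotate i x xs y

⟦x∷z∷xs⟧≡⟦z∷x∷xs⟧ : ∀ (x z : Fin v) xs → ⟦ x ∷ z ∷ xs ⟧ ≡ ⟦ z ∷ x ∷ xs ⟧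
⟦x∷z∷xs⟧≡⟦z∷x∷xs⟧ x z xs = begin
  ⁅ x ⁆ ∪ (⁅ z ⁆ ∪ ⟦ xs ⟧)  ≡⟨ ∪-assoc ⁅ x ⁆ ⁅ z ⁆ ⟦ xs ⟧ ⟨
  (⁅ x ⁆ ∪ ⁅ z ⁆) ∪ ⟦ xs ⟧  ≡⟨ cong (_∪ ⟦ xs ⟧) (∪-comm ⁅ x ⁆ ⁅ z ⁆) ⟩
  (⁅ z ⁆ ∪ ⁅ x ⁆) ∪ ⟦ xs ⟧  ≡⟨ ∪-assoc ⁅ z ⁆ ⁅ x ⁆ ⟦ xs ⟧ ⟩
  ⁅ z ⁆ ∪ (⁅ x ⁆ ∪ ⟦ xs ⟧)  ∎
  where open ≡-Reasoning

rotate-end : ∀ (x : Fin v) xs y → rotate (suc (length xs)) x xs y ≡ xs ∷ʳ y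
rotate-end x []       y = refl
rotate-end x (z ∷ xs) y = cong (z ∷_) (rotate-end x xs y)

length-rotate : ∀ i (x : Fin v) xs y → length (rotate i x xs y) ≡ suc (length xs)
length-rotate zero    x xs       y = refl
length-rotate (suc i) x []       y = refl
length-rotate (suc i) x (z ∷ xs) y = cong suc (length-rotate i x xs y)

-- The letter `x` is carried along until the last step, where `y` replaces it. So the top of every
-- intermediate flag is one of the two facets, and all its members are faces.
⟦rotate⟧ : ∀ i (x : Fin v) xs y →
  ⟦ rotate i x xs y ⟧ ≡ ⟦ x ∷ xs ⟧ ⊎ ⟦ rotate i x xs y ⟧ ≡ ⟦ xs ∷ʳ y ⟧
⟦rotate⟧ zero    x xs       y = inj₁ refl
⟦rotate⟧ (suc i) x []       y = inj₂ refl
⟦rotate⟧ (suc i) x (z ∷ xs) y with ⟦rotate⟧ i x xs y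
... | inj₁ eq = inj₁ (trans (cong (⁅ z ⁆ ∪_) eq) (⟦x∷z∷xs⟧≡⟦z∷x∷xs⟧ z x xs))
... | inj₂ eq = inj₂ (cong (⁅ z ⁆ ∪_) eq)

-- Step `i` exchanges the letters at positions i and i + 1, counted from 0, or replaces the last
-- letter; only the prefix of length i + 1 notices.
⟦take-rotate⟧ : ∀ i j (x : Fin v) xs y → j ≤ length xs → j ≢ i →
  ⟦ take (suc j) (rotate (suc i) x xs y) ⟧ ≡ ⟦ take (suc j) (rotate i x xs y) ⟧
⟦take-rotate⟧ zero    zero    x xs       y j≤ j≢i = contradiction refl j≢i
⟦take-rotate⟧ zero    (suc j) x (z ∷ xs) y j≤ j≢i = ⟦x∷z∷xs⟧≡⟦z∷x∷xs⟧ z x (take j xs)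
⟦take-rotate⟧ (suc i) j       x []       y j≤ j≢i = refl
⟦take-rotate⟧ (suc i) zero    x (z ∷ xs) y j≤ j≢i = refl
⟦take-rotate⟧ (suc i) (suc j) x (z ∷ xs) y (s≤s j≤) j≢i =
  cong (⁅ z ⁆ ∪_) (⟦take-rotate⟧ i j x xs y j≤ (j≢i ∘ cong suc))

x∈take-rotate : ∀ i (x : Fin v) xs y → i ≤ length xs →
  x ∈ ⟦ take (suc i) (rotate i x xs y) ⟧
x∈take-rotate zero    x xs       y i≤       = x∈⟦x∷xs⟧ x []
x∈take-rotate (suc i) x (z ∷ xs) y (s≤s i≤) =
  q⊆p∪q ⁅ z ⁆ _ (x∈take-rotate i x xs y i≤)

take-rotate⊆ : ∀ i (x : Fin v) xs y → ⟦ take i (rotate i x xs y) ⟧ ⊆ ⟦ xs ∷ʳ y ⟧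
take-rotate⊆ zero    x xs       y = ⊥⊆
take-rotate⊆ (suc zero)    x []       y = ⊆-refl
take-rotate⊆ (suc (suc i)) x []       y = ⊆-refl
take-rotate⊆ (suc i) x (z ∷ xs) y =
  ∪-lub (p⊆p∪q ⟦ xs ∷ʳ y ⟧) (q⊆p∪q ⁅ z ⁆ _ ∘ take-rotate⊆ i x xs y)

-- The letter `x` tells the prefixes apart: it ends the first one, and then it has moved beyond the
-- second or been replaced by `y`.
take-rotate-differs : ∀ i (x : Fin v) xs y → i ≤ length xs → x ∉ ⟦ xs ∷ʳ y ⟧ →
  ⟦ take (suc i) (rotate i x xs y) ⟧ ≢ ⟦ take (suc i) (rotate (suc i) x xs y) ⟧
take-rotate-differs i x xs y i≤ x∉ eq =
  x∉ (take-rotate⊆ (suc i) x xs y (subst (x ∈_) eq (x∈take-rotate i x xs y i≤)))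

-- Facets, flags and the uniqueness of T in a thin pure complex

module _ {v k : ℕ} (Δ : SimplicialComplex v) (pure : Pure Δ (suc k)) (thin : Thin Δ (suc k)) where

  open SimplicialComplex Δ

  private
    n : ℕ
    n = suc k

    infix 4 _≐ᶠ_
    _≐ᶠ_ : Flag Δ n → Flag Δ n → Set
    _≐ᶠ_ = _≐_ Δ n

  -- Greedy extension, where `d` bounds how many vertices can still be added; at `zero` the face
  -- already contains all `v` of them.
  face⊆facet : ∀ d {p} → Face p → v ≤ ∣ p ∣ + d → ∃[ q ] Facet q × p ⊆ q
  face⊆facet zero    {p} fp v≤ = p , (fp , maximal) , ⊆-refl
    where
    maximal : ∀ {q} → Face q → p ⊆ q → q ≡ p
    maximal {q} _ p⊆q = sym (⊆∧∣q∣≤∣p∣⇒≡ p⊆q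
      (≤-trans (∣p∣≤n q) (≤-trans v≤ (≤-reflexive (+-identityʳ ∣ p ∣)))))
  face⊆facet (suc d) {p} fp v≤ with any? (λ x → ¬? (x ∈? p) ×-dec face? (⁅ x ⁆ ∪ p))
  ... | yes (x , x∉p , fxp) with face⊆facet d fxp (begin
        v                    ≤⟨ v≤ ⟩
        ∣ p ∣ + suc d        ≡⟨ +-suc ∣ p ∣ d ⟩
        suc ∣ p ∣ + d        ≤⟨ +-monoˡ-≤ d (x∉p⇒∣⁅x⁆∪p∣ x∉p) ⟩
        ∣ ⁅ x ⁆ ∪ p ∣ + d    ∎)
    where open ≤-Reasoning
  ...   | q , facet , xp⊆q = q , facet , xp⊆q ∘ q⊆p∪q ⁅ x ⁆ p
  face⊆facet (suc d) {p} fp v≤ | no none = p , (fp , maximal) , ⊆-refl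
    where
    maximal : ∀ {q} → Face q → p ⊆ q → q ≡ p
    maximal {q} fq p⊆q with q ⊆? p
    ... | yes q⊆p = ⊆-antisym q⊆p p⊆q
    ... | no  q⊈p with ⊈⇒∃ q p q⊈p
    ...   | x , x∈q , x∉p =
      contradiction (x , x∉p , down-closed (∪-lub (⁅x⁆⊆p x∈q) p⊆q) fq) none

  -- Purity speaks only of facets, so the face is first enlarged to one, which then has the same
  -- size.
  face⇒facet : ∀ {p} → Face p → ∣ p ∣ ≡ n → Facet p
  face⇒facet {p} fp ∣p∣ with face⊆facet v fp (m≤n+m v ∣ p ∣)
  ... | q , facet , p⊆q = subst Facet (sym (⊆∧∣q∣≤∣p∣⇒≡ p⊆q
    (≤-reflexive (trans (pure facet) (sym ∣p∣))))) facet

  otherFacet-unique : ∀ {r p q q′} → ∣ r ∣ ≡ k → Facet p → Facet q → Facet q′ →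
    r ⊆ p → r ⊆ q → r ⊆ q′ → p ≢ q → p ≢ q′ → q ≡ q′
  otherFacet-unique ∣r∣ fp fq fq′ r⊆p r⊆q r⊆q′ p≢q p≢q′
    with thin (down-closed r⊆p (proj₁ fp) , cong suc ∣r∣)
  ... | X , Y , _ , _ , _ , only with only fp r⊆p | only fq r⊆q | only fq′ r⊆q′
  ... | inj₁ refl | inj₁ refl | _         = contradiction refl p≢q
  ... | inj₁ refl | inj₂ _    | inj₁ refl = contradiction refl p≢q′
  ... | inj₁ refl | inj₂ refl | inj₂ refl = refl
  ... | inj₂ refl | inj₂ refl | _         = contradiction refl p≢q
  ... | inj₂ refl | inj₁ _    | inj₂ refl = contradiction refl p≢q′
  ... | inj₂ refl | inj₁ refl | inj₁ refl = refl

  otherFacet : ∀ {r p} → ∣ r ∣ ≡ k → Facet p → r ⊆ p → ∃[ q ] Facet q × r ⊆ q × p ≢ q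
  otherFacet ∣r∣ fp r⊆p with thin (down-closed r⊆p (proj₁ fp) , cong suc ∣r∣)
  ... | X , Y , (fX , r⊆X) , (fY , r⊆Y) , X≢Y , only with only fp r⊆p
  ... | inj₁ refl = Y , fY , r⊆Y , X≢Y
  ... | inj₂ refl = X , fX , r⊆X , X≢Y ∘ sym

  -- The empty face is put under the first vertex, so that σ₀ needs no argument of its own.
  below : Flag Δ n → Fin n → Subset v
  below F zero    = ⊥
  below F (suc i) = face F (inject₁ i)

  ∣below∣ : ∀ (F : Flag Δ n) i → ∣ face F i ∣ ≡ suc ∣ below F i ∣
  ∣below∣ F zero    = trans (size F zero) (cong suc (sym (∣⊥∣≡0 v)))
  ∣below∣ F (suc i) =
    trans (size F (suc i)) (cong suc (sym (trans (size F (inject₁ i)) (cong suc (toℕ-inject₁ i)))))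

  below⊆ : ∀ (F : Flag Δ n) i → below F i ⊆ face F i
  below⊆ F zero    = ⊥⊆
  below⊆ F (suc i) = proj₁ (strict F (s≤s (≤-reflexive (toℕ-inject₁ i))))

  below-cong : ∀ {F G : Flag Δ n} {i} → (∀ j → j ≢ i → face F j ≡ face G j) → below F i ≡ below G i
  below-cong {i = zero}  eq = refl
  below-cong {i = suc i} eq = eq (inject₁ i) (λ inj≡ → <-irrefl
    (trans (sym (toℕ-inject₁ i)) (cong toℕ inj≡)) ≤-refl)

  topFacet : (F : Flag Δ n) → Facet (face F (fromℕ k))
  topFacet F = face⇒facet (isFace F (fromℕ k))
    (trans (size F (fromℕ k)) (cong suc (toℕ-fromℕ k)))

  -- Below the top, the face lies between two faces of the flag that differ by two vertices, and
  -- `diamond` leaves one alternative. The top face has nothing above it; there thinness takes over.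
  σ-middle : ∀ i {F G G′} → IsSigma Δ n i F G → IsSigma Δ n i F G′ → face G i ≡ face G′ i
  σ-middle i {F} {G} {G′} (F≢G , F≡G) (F≢G′ , F≡G′) with view i
  ... | ‵fromℕ = otherFacet-unique {r = below F (fromℕ k)}
    (suc-injective (trans (sym (∣below∣ F (fromℕ k))) (pure (topFacet F))))
    (topFacet F) (topFacet G) (topFacet G′) (below⊆ F (fromℕ k))
    (subst (_⊆ _) (sym (below-cong {F} {G} F≡G)) (below⊆ G (fromℕ k)))
    (subst (_⊆ _) (sym (below-cong {F} {G′} F≡G′)) (below⊆ G′ (fromℕ k)))
    F≢G F≢G′
  ... | ‵inject₁ j = diamond {a = below F i′}
    (below⊆ F i′)
    (subst (_⊆ _) (sym b≡) (below⊆ G i′))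
    (subst (_⊆ _) (sym b≡′) (below⊆ G′ i′))
    (below⊆ F (suc j))
    (subst (face G i′ ⊆_) (sym (F≡G (suc j) sj≢i)) (below⊆ G (suc j)))
    (subst (face G′ i′ ⊆_) (sym (F≡G′ (suc j) sj≢i)) (below⊆ G′ (suc j)))
    (∣below∣ F i′)
    (trans (∣below∣ G i′) (cong (suc ∘ ∣_∣) (sym b≡)))
    (trans (∣below∣ G′ i′) (cong (suc ∘ ∣_∣) (sym b≡′)))
    (∣below∣ F (suc j))
    F≢G F≢G′
    where
    i′ : Fin n
    i′ = inject₁ j
    b≡ : below F i′ ≡ below G i′
    b≡ = below-cong {F} {G} F≡G
    b≡′ : below F i′ ≡ below G′ i′
    b≡′ = below-cong {F} {G′} F≡G′
    sj≢i : suc j ≢ i′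
    sj≢i eq = <-irrefl (trans (sym (toℕ-inject₁ j)) (sym (cong toℕ eq))) ≤-refl

  σ-functional : ∀ i {F F′ G G′} → F ≐ᶠ F′ → IsSigma Δ n i F G → IsSigma Δ n i F′ G′ → G ≐ᶠ G′
  σ-functional i {F} {F′} {G} {G′} F≐F′ σ@(F≢G , F≡G) (F′≢G′ , F′≡G′) j with j Fin.≟ i
  ... | yes refl = σ-middle i {F} {G} {G′} σ
    ((λ eq → F′≢G′ (trans (sym (F≐F′ i)) eq)) , (λ j j≢i → trans (F≐F′ j) (F′≡G′ j j≢i)))
  ... | no j≢i = trans (sym (F≡G j j≢i)) (trans (F≐F′ j) (F′≡G′ j j≢i))

  T-functional : ∀ {F F′ G G′} → F ≐ᶠ F′ → IsT Δ n F G → IsT Δ n F′ G′ → G ≐ᶠ G′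
  T-functional F≐F′ (H , H₀ , σ , Hₙ) (H′ , H₀′ , σ′ , Hₙ′) j =
    trans (sym (Hₙ j)) (trans (H≐H′ (fromℕ n) j) (Hₙ′ j))
    where
    H≐H′ : ∀ i → H i ≐ᶠ H′ i
    H≐H′ = <-weakInduction (λ i → H i ≐ᶠ H′ i)
      (λ j → trans (H₀ j) (trans (F≐F′ j) (sym (H₀′ j))))
      (λ i eq → σ-functional i {H (inject₁ i)} {H′ (inject₁ i)} {H (suc i)} {H′ (suc i)} eq (σ i) (σ′ i))

  -- T is a function up to `≐`, so agreement at a single index propagates to all later ones.
  flags-agree : ∀ (Z W : Zigzag Δ n) {j} → flag Z j ≐ᶠ flag W 0 → ∀ i → flag W i ≐ᶠ flag Z (j + i)
  flags-agree Z W {j} eq zero    l =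
    trans (sym (eq l)) (cong (λ j → face (flag Z j) l) (sym (+-identityʳ j)))
  flags-agree Z W {j} eq (suc i) l = trans
    (T-functional {flag W i} {flag Z (j + i)} {flag W (suc i)} {flag Z (suc (j + i))}
      (flags-agree Z W eq i) (step W i) (step Z (j + i)) l)
    (cong (λ j → face (flag Z j) l) (sym (+-suc j i)))

  -- Flags as words and T as a shift of words

  -- Equality of length and cardinality says that the word has no repetitions.
  record OrderedFacet : Set where
    constructor ordered
    field
      word      : List (Fin v)
      length≡n  : length word ≡ n
      card≡n    : ∣ ⟦ word ⟧ ∣ ≡ n
      face-word : Face ⟦ word ⟧

    card≡length : ∣ ⟦ word ⟧ ∣ ≡ length word
    card≡length = trans card≡n (sym length≡n)

    facet : Facet ⟦ word ⟧
    facet = face⇒facet face-word card≡n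

  open OrderedFacet

  toFlag : OrderedFacet → Flag Δ n
  toFlag S .face i   = ⟦ take (suc (toℕ i)) (word S) ⟧
  toFlag S .isFace i = down-closed (⟦take⟧⊆ (suc (toℕ i)) (word S)) (face-word S)
  toFlag S .size i   = ∣⟦take⟧∣ (suc (toℕ i)) (word S) (card≡length S)
    (≤-trans (toℕ<n i) (≤-reflexive (sym (length≡n S))))
  toFlag S .strict {i} {j} i<j = ⟦take⟧-mono (word S) (s≤s (<⇒≤ i<j)) ,
    ∣p∣<∣q∣⇒∃ _ _ (≤-trans (s≤s (≤-trans (≤-reflexive (toFlag S .size i)) i<j))
      (≤-reflexive (sym (toFlag S .size j))))

  toFlag-top : ∀ S → face (toFlag S) (fromℕ k) ≡ ⟦ word S ⟧
  toFlag-top S = cong ⟦_⟧ (take-all (suc (toℕ (fromℕ k))) (word S)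
    (≤-reflexive (trans (length≡n S) (cong suc (sym (toℕ-fromℕ k))))))

  -- The letters are the vertices gained from one face to the next; prepending `⊥` makes the first
  -- vertex a gain as well.
  fromFlag : ∀ (F : Flag Δ n) → ∃[ S ] F ≐ᶠ toFlag S
  fromFlag F with chain⇒word chain chain-mono chain-card
    where
    chain : Fin (suc n) → Subset v
    chain zero    = ⊥
    chain (suc i) = face F i

    below≡chain : ∀ i → below F i ≡ chain (inject₁ i)
    below≡chain zero    = refl
    below≡chain (suc i) = refl

    chain-mono : ∀ i → chain (inject₁ i) ⊆ chain (suc i)
    chain-mono i = subst (_⊆ face F i) (below≡chain i) (below⊆ F i)

    chain-card : ∀ i → ∣ chain (suc i) ∣ ≡ suc ∣ chain (inject₁ i) ∣
    chain-card i = trans (∣below∣ F i) (cong (suc ∘ ∣_∣) (below≡chain i))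
  ... | xs , len , eq = ordered xs len
    (trans (cong ∣_∣ ⟦xs⟧≡) (pure (topFacet F)))
    (subst Face (sym ⟦xs⟧≡) (isFace F (fromℕ k))) , F≐
    where
    F≐ : ∀ i → face F i ≡ ⟦ take (suc (toℕ i)) xs ⟧
    F≐ i = trans (sym (eq (suc i))) (∪-identityˡ _)

    ⟦xs⟧≡ : ⟦ xs ⟧ ≡ face F (fromℕ k)
    ⟦xs⟧≡ = trans (cong ⟦_⟧ (sym (take-all (suc (toℕ (fromℕ k))) xs
      (≤-reflexive (trans len (cong suc (sym (toℕ-fromℕ k)))))))) (sym (F≐ (fromℕ k)))

  -- The side condition makes the two facets differ. Between words of ordered facets, such a shift
  -- is one application of T.
  data _↝_ : List (Fin v) → List (Fin v) → Set where
    shift : ∀ {x xs y} → x ∉ ⟦ xs ∷ʳ y ⟧ → (x ∷ xs) ↝ (xs ∷ʳ y)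

  ↝⇒T : ∀ S S′ → word S ↝ word S′ → IsT Δ n (toFlag S) (toFlag S′)
  ↝⇒T (ordered (x ∷ xs) len card f) (ordered .(xs ∷ʳ y) len′ card′ f′) (shift {y = y} x∉) =
    toFlag ∘ rotated ∘ toℕ , (λ j → refl) , σ , λ j → cong (⟦_⟧ ∘ take (suc (toℕ j))) end
    where
    rotated : ℕ → OrderedFacet
    rotated i .word     = rotate i x xs y
    rotated i .length≡n = trans (length-rotate i x xs y) len
    rotated i .card≡n with ⟦rotate⟧ i x xs y
    ... | inj₁ eq = trans (cong ∣_∣ eq) card
    ... | inj₂ eq = trans (cong ∣_∣ eq) card′
    rotated i .face-word with ⟦rotate⟧ i x xs y
    ... | inj₁ eq = subst Face (sym eq) f
    ... | inj₂ eq = subst Face (sym eq) f′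

    ≤length : ∀ (i : Fin n) → toℕ i ≤ length xs
    ≤length i = ≤-trans (toℕ≤pred[n] i) (≤-reflexive (sym (suc-injective len)))

    σ : ∀ i → IsSigma Δ n i (toFlag (rotated (toℕ (inject₁ i)))) (toFlag (rotated (suc (toℕ i))))
    σ i rewrite toℕ-inject₁ i =
      take-rotate-differs (toℕ i) x xs y (≤length i) x∉ ,
      λ j j≢i → sym (⟦take-rotate⟧ (toℕ i) (toℕ j) x xs y (≤length j) (j≢i ∘ toℕ-injective))

    end : rotate (toℕ (fromℕ n)) x xs y ≡ xs ∷ʳ y
    end = trans (cong (λ i → rotate i x xs y) (trans (toℕ-fromℕ n) (sym len))) (rotate-end x xs y)

  -- The letter to append is the vertex that the other facet through the ridge `⟦ xs ⟧` has outside
  -- the current facet.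
  advance : ∀ S → ∃[ S′ ] word S ↝ word S′
  advance (ordered (x ∷ xs) len card f)
    with ∣⟦x∷xs⟧∣-tail x xs (trans card (sym len))
  ... | x∉xs , ∣xs∣ with trans ∣xs∣ (suc-injective len)
  ... | ∣xs∣≡k with otherFacet ∣xs∣≡k (face⇒facet f card) (⟦xs⟧⊆⟦x∷xs⟧ x xs)
  ... | q , fq , xs⊆q , p≢q with p≢q⇒∃ ⟦ x ∷ xs ⟧ q (trans card (sym (pure fq))) p≢q
  ... | y , y∈q , y∉p = ordered (xs ∷ʳ y)
    (trans (length-++ xs) (trans (+-comm (length xs) 1) len))
    (trans (cong ∣_∣ xsy≡q) (pure fq))
    (subst Face (sym xsy≡q) (proj₁ fq)) , shift x∉
    where
    xsy≡q : ⟦ xs ∷ʳ y ⟧ ≡ q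
    xsy≡q = trans (⟦∷ʳ⟧ xs y)
      (⁅x⁆∪p≡q xs⊆q (trans (pure fq) (cong suc (sym ∣xs∣≡k))) y∈q (y∉p ∘ ⟦xs⟧⊆⟦x∷xs⟧ x xs))

    x∉ : x ∉ ⟦ xs ∷ʳ y ⟧
    x∉ x∈ with x∈p∪q⁻ ⁅ y ⁆ ⟦ xs ⟧ (subst (x ∈_) (⟦∷ʳ⟧ xs y) x∈)
    ... | inj₁ x∈⁅y⁆ =
      y∉p (subst (_∈ ⟦ x ∷ xs ⟧) (x∈⁅y⁆⇒x≡y y x∈⁅y⁆) (x∈⟦x∷xs⟧ x xs))
    ... | inj₂ x∈xs  = x∉xs x∈xs

  orbit : OrderedFacet → ℕ → OrderedFacet
  orbit S zero    = S
  orbit S (suc i) = orbit (proj₁ (advance S)) i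

  orbit-step : ∀ S i → IsT Δ n (toFlag (orbit S i)) (toFlag (orbit S (suc i)))
  orbit-step S zero    = ↝⇒T S (proj₁ (advance S)) (proj₂ (advance S))
  orbit-step S (suc i) = orbit-step (proj₁ (advance S)) i

  zigzag : OrderedFacet → Zigzag Δ n
  zigzag S .flag   = toFlag ∘ orbit S
  zigzag S .step i = orbit-step S i

  -- Zigzags along a straight sequence of facets

  -- For facets, ∣ X ─ Y ∣ ≡ d is ∣ X ∩ Y ∣ ≡ n ∸ d without truncated subtraction.
  Straight : (ℕ → Subset v) → ℕ → Set
  Straight X m = ∀ i d → i + d ≤ m → d ≤ n → ∣ X i ─ X (i + d) ∣ ≡ d

  -- The invariant of `follow`. The bound `l ≤ n` is there because a word has only n letters, all of
  -- which are discarded within n steps.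
  Departs : List (Fin v) → (ℕ → Subset v) → ℕ → Set
  Departs xs X m = ∀ l → l ≤ m → l ≤ n → ∀ {z} → z ∈ ⟦ take l xs ⟧ → z ∉ X l

  -- `X ─ Y` has one element and contains the first letter, so every other letter stays in `Y`.
  -- Hence `Y` is a facet through the ridge of the remaining letters, different from `X`, and
  -- thinness allows only one.
  ↝-determined : ∀ S S′ {X Y} → word S ↝ word S′ → ⟦ word S ⟧ ≡ X → Facet Y → ∣ X ─ Y ∣ ≡ 1 →
    (∀ {z} → z ∈ ⟦ take 1 (word S) ⟧ → z ∉ Y) → ⟦ word S′ ⟧ ≡ Y
  ↝-determined S@(ordered (x ∷ xs) len card f) S′@(ordered .(xs ∷ʳ y) _ _ _) {Y = Y}
    (shift {y = y} x∉) refl fY ∣X─Y∣ departs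
    with ∣⟦x∷xs⟧∣-tail x xs (card≡length S)
  ... | x∉xs , ∣xs∣ = otherFacet-unique (trans ∣xs∣ (suc-injective len)) (facet S) (facet S′) fY
    xs⊆X (subst (⟦ xs ⟧ ⊆_) (sym (⟦∷ʳ⟧ xs y)) (q⊆p∪q ⁅ y ⁆ ⟦ xs ⟧)) xs⊆Y
    (λ eq → x∉ (subst (x ∈_) eq x∈X)) (λ eq → x∉Y (subst (x ∈_) eq x∈X))
    where
    x∈X : x ∈ ⟦ x ∷ xs ⟧
    x∈X = x∈⟦x∷xs⟧ x xs

    xs⊆X : ⟦ xs ⟧ ⊆ ⟦ x ∷ xs ⟧
    xs⊆X = ⟦xs⟧⊆⟦x∷xs⟧ x xs

    x∉Y : x ∉ Y
    x∉Y = departs (x∈⟦x∷xs⟧ x [])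

    xs⊆Y : ⟦ xs ⟧ ⊆ Y
    xs⊆Y {z} z∈ with z ∈? Y
    ... | yes z∈Y = z∈Y
    ... | no  z∉Y = contradiction
      (subst (_∈ ⟦ xs ⟧) (∣p─q∣≡1⇒unique ∣X─Y∣ x∈X x∉Y (xs⊆X z∈) z∉Y) z∈) x∉xs

  ↝-take : ∀ {xs ys} l → xs ↝ ys → suc l ≤ length xs → ⟦ take l ys ⟧ ⊆ ⟦ take (suc l) xs ⟧
  ↝-take l (shift {x} {xs} {y} _) (s≤s l≤) =
    subst (λ s → ⟦ s ⟧ ⊆ ⟦ x ∷ take l xs ⟧) (sym (take-++ l xs [ y ] l≤)) (⟦xs⟧⊆⟦x∷xs⟧ x (take l xs))

  -- After one step the hypotheses hold again for the new word and `X ∘ suc`, although the new word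
  -- ends in a letter about which `departs` says nothing.
  follow : ∀ i {m X} S → (∀ l → Facet (X l)) → Straight X m → ⟦ word S ⟧ ≡ X 0 →
    Departs (word S) X m → i ≤ m → ⟦ word (orbit S i) ⟧ ≡ X i
  follow zero    S facets straight start departs i≤m = start
  follow (suc i) {suc m} {X} S facets straight start departs (s≤s i≤m) =
    follow i {m} {X ∘ suc} S′ (facets ∘ suc) (λ i d i+d≤m → straight (suc i) d (s≤s i+d≤m))
      start′ departs′ i≤m
    where
    S′ : OrderedFacet
    S′ = proj₁ (advance S)

    start′ : ⟦ word S′ ⟧ ≡ X 1
    start′ = ↝-determined S S′ (proj₂ (advance S)) start (facets 1)
      (straight 0 1 (s≤s z≤n) (s≤s z≤n)) (departs 1 (s≤s z≤n) (s≤s z≤n))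

    -- After n steps the whole facet X 1 has been left, since X 1 and
    -- X (suc n) are disjoint.
    departs′ : Departs (word S′) (X ∘ suc) m
    departs′ l l≤m l≤n {z} z∈ with m≤n⇒m<n∨m≡n l≤n
    ... | inj₁ l<n  = departs (suc l) (s≤s l≤m) l<n
      (↝-take l (proj₂ (advance S)) (≤-trans l<n (≤-reflexive (sym (length≡n S)))) z∈)
    ... | inj₂ refl = x∈p─q⇒x∉q (X 1) (X (suc n)) (subst (_ ∈_) (sym X₁─X) z∈X₁)
      where
      z∈X₁ : z ∈ X 1
      z∈X₁ = subst (_ ∈_) start′ (⟦take⟧⊆ l (word S′) z∈)
      X₁─X : X 1 ─ X (suc n) ≡ X 1
      X₁─X = ⊆∧∣q∣≤∣p∣⇒≡ (p─q⊆p (X 1) (X (suc n)))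
        (≤-reflexive (trans (pure (facets 1)) (sym (straight 1 n (s≤s l≤m) ≤-refl))))

  departing-order : ∀ m X → (∀ l → Facet (X l)) → Straight X m →
    ∃[ S ] ⟦ word S ⟧ ≡ X 0 × Departs (word S) X m
  departing-order m X facets straight
    with chain⇒word left left-mono left-card
    where
    -- The chain stops at `m ⊓ n`: the path ends at m, and straightness controls losses only up to
    -- n.
    left : Fin (suc (m ⊓ n)) → Subset v
    left i = X 0 ─ X (toℕ i)

    ∣left∣ : ∀ {l} → l ≤ m ⊓ n → ∣ X 0 ─ X l ∣ ≡ l
    ∣left∣ {l} l≤ = straight 0 l (≤-trans l≤ (m⊓n≤m m n)) (≤-trans l≤ (m⊓n≤n m n))

    left-card : ∀ i → ∣ left (suc i) ∣ ≡ suc ∣ left (inject₁ i) ∣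
    left-card i = trans (∣left∣ (toℕ<n i)) (cong suc (sym (trans
      (∣left∣ (≤-trans (≤-reflexive (toℕ-inject₁ i)) (<⇒≤ (toℕ<n i)))) (toℕ-inject₁ i))))

    -- A vertex returning at step l + 1 would make X 0 ─ X (l + 1) smaller
    -- than the l + 1 vertices it must contain.
    left-mono′ : ∀ l → suc l ≤ m ⊓ n → X 0 ─ X l ⊆ X 0 ─ X (suc l)
    left-mono′ l l< {z} z∈ with z ∈? X (suc l)
    ... | no  z∉ = x∈p∧x∉q⇒x∈p─q (p─q⊆p (X 0) (X l) z∈) z∉
    ... | yes z∈′ = contradiction (begin
      suc (suc l)                                      ≡⟨ cong suc (∣left∣ l<) ⟨
      suc ∣ X 0 ─ X (suc l) ∣                          ≤⟨ p⊂q⇒∣p∣<∣q∣ proper ⟩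
      ∣ (X 0 ─ X l) ∪ (X l ─ X (suc l)) ∣              ≤⟨ ∣p∪q∣≤∣p∣+∣q∣ (X 0 ─ X l) (X l ─ X (suc l)) ⟩
      ∣ X 0 ─ X l ∣ + ∣ X l ─ X (suc l) ∣              ≡⟨ cong₂ _+_ (∣left∣ (<⇒≤ l<)) one ⟩
      l + 1                                            ≡⟨ +-comm l 1 ⟩
      suc l                                            ∎) (<⇒≱ ≤-refl)
      where
      open ≤-Reasoning
      one : ∣ X l ─ X (suc l) ∣ ≡ 1
      one = subst (λ i → ∣ X l ─ X i ∣ ≡ 1) (+-comm l 1)
        (straight l 1 (≤-trans (≤-reflexive (+-comm l 1)) (≤-trans l< (m⊓n≤m m n))) (s≤s z≤n))
      proper : X 0 ─ X (suc l) ⊂ (X 0 ─ X l) ∪ (X l ─ X (suc l))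
      proper = p─r⊆p─q∪q─r (X 0) (X l) (X (suc l)) , z , p⊆p∪q _ z∈ ,
        λ z∈─ → x∈p─q⇒x∉q (X 0) (X (suc l)) z∈─ z∈′

    left-mono : ∀ i → left (inject₁ i) ⊆ left (suc i)
    left-mono i = subst (λ l → X 0 ─ X l ⊆ left (suc i)) (sym (toℕ-inject₁ i))
      (left-mono′ (toℕ i) (toℕ<n i))
  ... | xs , len , eq = complete
    where
    prefix : ∀ {l} → l ≤ m ⊓ n → ⟦ take l xs ⟧ ≡ X 0 ─ X l
    prefix {l} l≤ = begin
      ⟦ take l xs ⟧                                 ≡⟨ ∪-identityˡ _ ⟨
      ⊥ ∪ ⟦ take l xs ⟧                             ≡⟨ cong₂ _∪_ X₀─X₀ (cong (⟦_⟧ ∘ λ l → take l xs) toℕ≡) ⟨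
      (X 0 ─ X 0) ∪ ⟦ take (toℕ i) xs ⟧             ≡⟨ eq i ⟩
      X 0 ─ X (toℕ i)                               ≡⟨ cong (λ l → X 0 ─ X l) toℕ≡ ⟩
      X 0 ─ X l                                     ∎
      where
      open ≡-Reasoning
      i : Fin (suc (m ⊓ n))
      i = Fin.fromℕ< (s≤s l≤)
      toℕ≡ : toℕ i ≡ l
      toℕ≡ = toℕ-fromℕ< (s≤s l≤)
      X₀─X₀ : X 0 ─ X 0 ≡ ⊥
      X₀─X₀ = sym (⊆∧∣q∣≤∣p∣⇒≡ ⊥⊆ (≤-trans (≤-reflexive (straight 0 0 z≤n z≤n)) z≤n))

    ⟦xs⟧≡ : ⟦ xs ⟧ ≡ X 0 ─ X (m ⊓ n)
    ⟦xs⟧≡ = trans (cong ⟦_⟧ (sym (take-all (m ⊓ n) xs (≤-reflexive len)))) (prefix ≤-refl)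

    ∣⟦xs⟧∣ : ∣ ⟦ xs ⟧ ∣ ≡ m ⊓ n
    ∣⟦xs⟧∣ = trans (cong ∣_∣ ⟦xs⟧≡) (straight 0 (m ⊓ n) (m⊓n≤m m n) (m⊓n≤n m n))

    complete : ∃[ S ] ⟦ word S ⟧ ≡ X 0 × Departs (word S) X m
    -- The vertices of `X 0` not lost in these `m ⊓ n` steps are appended in any order; `Departs`
    -- never inspects them.
    complete with interpolate (n ∸ (m ⊓ n)) (subst (_⊆ X 0) (sym ⟦xs⟧≡) (p─q⊆p (X 0) _))
      (trans (cong (_+ (n ∸ (m ⊓ n))) ∣⟦xs⟧∣) (trans (m+[n∸m]≡n (m⊓n≤n m n)) (sym (pure (facets 0)))))
    ... | ys , len′ , eq′ = ordered (xs ++ ys)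
      (trans (length-++ xs) (trans (cong₂ _+_ len len′) (m+[n∸m]≡n (m⊓n≤n m n))))
      (trans (cong ∣_∣ full) (pure (facets 0)))
      (subst Face (sym full) (proj₁ (facets 0))) , full , departs
      where
      full : ⟦ xs ++ ys ⟧ ≡ X 0
      full = trans (⟦++⟧ xs ys) eq′
      departs : Departs (xs ++ ys) X m
      departs l l≤m l≤n z∈ = x∈p─q⇒x∉q (X 0) (X l) (subst (_ ∈_) (trans
        (cong ⟦_⟧ (take-++ l xs ys (≤-trans (⊓-glb l≤m l≤n) (≤-reflexive (sym len)))))
        (prefix (⊓-glb l≤m l≤n))) z∈)

  follows-straight : ∀ m X → (∀ l → Facet (X l)) → Straight X m →
    ∃[ S ] (∀ i → i ≤ m → ⟦ word (orbit S i) ⟧ ≡ X i)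
  follows-straight m X facets straight =
    let S , start , departs = departing-order m X facets straight
    in S , λ i → follow i {m} {X} S facets straight start departs

  -- The discarded letter `x` lies in the common first facet. Were it among the letters `ys`, it
  -- would survive into the second facet, which is common too; but `x` is not there. So `x` is `y`.
  ↝-agree : ∀ r {xs ys xs′ ys′} → xs ↝ xs′ → ys ↝ ys′ → length xs ≡ length ys →
    ⟦ xs ⟧ ≡ ⟦ ys ⟧ → ⟦ xs′ ⟧ ≡ ⟦ ys′ ⟧ → take r xs′ ≡ take r ys′ → take (suc r) xs ≡ take (suc r) ys
  ↝-agree r (shift {x} {xs} {x′} x∉) (shift {y} {ys} {y′} _) len eq eq′ agree
    with x∈p∪q⁻ ⁅ y ⁆ ⟦ ys ⟧ (subst (x ∈_) eq (x∈⟦x∷xs⟧ x xs))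
  ... | inj₁ x∈⁅y⁆ = cong₂ _∷_ (x∈⁅y⁆⇒x≡y y x∈⁅y⁆)
    (take-∷ʳ-injective r xs ys (suc-injective len) agree)
  ... | inj₂ x∈ys  = contradiction
    (subst (x ∈_) (sym (trans eq′ (⟦∷ʳ⟧ ys y′))) (q⊆p∪q ⁅ y′ ⁆ ⟦ ys ⟧ x∈ys)) x∉

  -- Letters are recovered from the end of the path backwards, each from two consecutive facets. For
  -- `r ≥ n` the prefix is the whole word, so the words coincide.
  shadow-determines-prefix : ∀ r S T →
    (∀ i → i ≤ r → ⟦ word (orbit S i) ⟧ ≡ ⟦ word (orbit T i) ⟧) → take r (word S) ≡ take r (word T)
  shadow-determines-prefix zero    S T eq = refl
  shadow-determines-prefix (suc r) S T eq =
    ↝-agree r (proj₂ (advance S)) (proj₂ (advance T)) (trans (length≡n S) (sym (length≡n T)))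
      (eq 0 z≤n) (eq 1 (s≤s z≤n))
      (shadow-determines-prefix r (proj₁ (advance S)) (proj₁ (advance T)) (λ i i≤r → eq (suc i) (s≤s i≤r)))

  -- Counting the zigzags along a path

  Through : (ℕ → Subset v) → ℕ → Zigzag Δ n → Set
  Through X m Z = ∃[ j ] (∀ i → i ≤ m → shadow Δ n Z (j + i) ≡ X i)

  HasWordIn : List (List (Fin v)) → Zigzag Δ n → Set
  HasWordIn ws Z = ∃[ j ] ∃[ S ] (flag Z j ≐ᶠ toFlag S) × word S ∈ˡ ws

  -- A list need not be the word of a facet. Whether it is can be decided, and dropping a failing
  -- entry only lowers the count. The zigzag of a valid entry is a shift of every zigzag in which
  -- that word occurs.
  atMost-words : ∀ ws → AtMost Δ n (length ws) (HasWordIn ws)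
  atMost-words [] = [] , z≤n , λ { Z (_ , _ , _ , ()) }
  atMost-words (w ∷ ws) with atMost-words ws
  ... | Zs , len , complete
    with length w ≟ n ×-dec (∣ ⟦ w ⟧ ∣ ≟ n ×-dec face? ⟦ w ⟧)
  ... | no invalid = Zs , m≤n⇒m≤1+n len , complete′
    where
    complete′ : ∀ Z → HasWordIn (w ∷ ws) Z → Any (_≈_ Δ n Z) Zs
    complete′ Z (j , S , eq , here refl) = contradiction (length≡n S , card≡n S , face-word S) invalid
    complete′ Z (j , S , eq , there w∈)  = complete Z (j , S , eq , w∈)
  ... | yes (a , b , c) = zigzag W ∷ Zs , s≤s len , complete′
    where
    W : OrderedFacet
    W = ordered w a b c
    complete′ : ∀ Z → HasWordIn (w ∷ ws) Z → Any (_≈_ Δ n Z) (zigzag W ∷ Zs)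
    complete′ Z (j , S , eq , here refl) = here (return (inj₁ (j , flags-agree Z (zigzag W) eq)))
    complete′ Z (j , S , eq , there w∈)  = there (complete Z (j , S , eq , w∈))

  through-straight : ∀ m X → (∀ l → Facet (X l)) → Straight X m →
    ∃[ Z ] (∀ i → i ≤ m → shadow Δ n Z i ≡ X i)
  through-straight m X facets straight =
    let S , follows = follows-straight m X facets straight
    in zigzag S , λ i i≤m → trans (toFlag-top (orbit S i)) (follows i i≤m)

  -- The word with which another zigzag enters the path has the same first m letters as `word S` and
  -- the same set of letters, so it is that prefix followed by a rearrangement of the rest.
  atMost-through : ∀ m X S → (∀ i → i ≤ m → ⟦ word (orbit S i) ⟧ ≡ X i) →
    AtMost Δ n ((n ∸ m) !) (Through X m)
  atMost-through m X S follows =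
    let Zs , len , complete = atMost-words words
    in Zs , ≤-trans len (≤-reflexive length-words) , λ Z through → complete Z (hasWord Z through)
    where
    words : List (List (Fin v))
    words = map (take m (word S) ++_) (orders (drop m (word S)))

    length-words : length words ≡ (n ∸ m) !
    length-words = begin
      length words                           ≡⟨ length-map _ (orders (drop m (word S))) ⟩
      length (orders (drop m (word S)))      ≡⟨ length-orders (drop m (word S)) ⟩
      length (drop m (word S)) !             ≡⟨ cong _! (length-drop m (word S)) ⟩
      (length (word S) ∸ m) !                ≡⟨ cong (λ l → (l ∸ m) !) (length≡n S) ⟩
      (n ∸ m) !                              ∎
      where open ≡-Reasoning

    hasWord : ∀ Z → Through X m Z → HasWordIn words Z
    hasWord Z (j , through) with fromFlag (flag Z j)
    ... | T , eq = j , T , eq , subst (_∈ˡ _)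
      (trans (cong (_++ drop m (word T)) (sym prefix)) (take++drop≡id m (word T)))
      (∈-map⁺ (take m (word S) ++_) (∈-orders (drop m (word S)) rest))
      where
      shadows : ∀ i → i ≤ m → ⟦ word (orbit T i) ⟧ ≡ ⟦ word (orbit S i) ⟧
      shadows i i≤m = begin
        ⟦ word (orbit T i) ⟧               ≡⟨ toFlag-top (orbit T i) ⟨
        shadow Δ n (zigzag T) i            ≡⟨ flags-agree Z (zigzag T) eq i (fromℕ k) ⟩
        shadow Δ n Z (j + i)               ≡⟨ through i i≤m ⟩
        X i                                ≡⟨ follows i i≤m ⟨
        ⟦ word (orbit S i) ⟧               ∎
        where open ≡-Reasoning

      prefix : take m (word T) ≡ take m (word S)
      prefix = shadow-determines-prefix m T S shadows

      rest : drop m (word T) ↭ drop m (word S)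
      rest = ++-cancelˡ-↭ (take m (word S)) (subst₂ _↭_
        (trans (sym (take++drop≡id m (word T))) (cong (_++ drop m (word T)) prefix))
        (sym (take++drop≡id m (word S)))
        (⟦⟧≡⇒↭ (word T) (word S) (card≡length T) (card≡length S) (shadows 0 z≤n)))

  -- Paths in a form that concatenates, distance and lost vertices

  data Walk : Subset v → Subset v → ℕ → Set where
    stop : ∀ {X} → Facet X → Walk X X 0
    _◂_  : ∀ {X Y Z l} → Adjacent Δ n X Y → Walk Y Z l → Walk X Z (suc l)

  infixr 5 _◂_ _◂◂_

  _◂◂_ : ∀ {X Y Z l l′} → Walk X Y l → Walk Y Z l′ → Walk X Z (l + l′)
  stop _  ◂◂ w′ = w′
  (a ◂ w) ◂◂ w′ = a ◂ (w ◂◂ w′)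

  path⇒walk : ∀ {X Y l} → PathBetween Δ n X Y l → Walk X Y l
  path⇒walk {l = zero}  (P , (facets , _) , refl , refl) = stop (facets zero)
  path⇒walk {l = suc l} (P , (facets , adj) , refl , refl) =
    adj zero ◂ path⇒walk (P ∘ suc , (facets ∘ suc , adj ∘ suc) , refl , refl)

  walk⇒path : ∀ {X Y l} → Walk X Y l → PathBetween Δ n X Y l
  walk⇒path {X} (stop fX) = (λ _ → X) , ((λ _ → fX) , λ ()) , refl , refl
  walk⇒path {X} {l = suc l} (a ◂ w) with walk⇒path w
  ... | P , (facets , adj) , refl , refl = P′ , (facets′ , adj′) , refl , refl
    where
    P′ : Vector (Subset v) (suc (suc l))
    P′ zero    = X
    P′ (suc i) = P i
    facets′ : ∀ i → Facet (P′ i)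
    facets′ zero    = proj₁ a
    facets′ (suc i) = facets i
    adj′ : ∀ i → Adjacent Δ n (P′ (inject₁ i)) (P′ (suc i))
    adj′ zero    = a
    adj′ (suc i) = adj i

  ∣p─q∣≡n∸∣p∩q∣ : ∀ {p q} → Facet p → ∣ p ─ q ∣ ≡ n ∸ ∣ p ∩ q ∣
  ∣p─q∣≡n∸∣p∩q∣ {p} {q} fp = sym (trans
    (cong (_∸ ∣ p ∩ q ∣) (trans (sym (pure fp)) (sym (∣p∩q∣+∣p─q∣≡∣p∣ p q))))
    (m+n∸m≡n ∣ p ∩ q ∣ ∣ p ─ q ∣))

  adjacent⇒∣─∣ : ∀ {p q} → Adjacent Δ n p q → ∣ p ─ q ∣ ≡ 1
  adjacent⇒∣─∣ {p} {q} (fp , _ , _ , ridge) = trans (∣p─q∣≡n∸∣p∩q∣ fp)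
    (trans (cong (_∸ ∣ p ∩ q ∣) (sym ridge)) (m+n∸n≡m 1 ∣ p ∩ q ∣))

  -- Each step loses one vertex, and losses are subadditive.
  walk⇒∣─∣≤ : ∀ {X Y l} → Walk X Y l → ∣ X ─ Y ∣ ≤ l
  walk⇒∣─∣≤ {X} (stop fX) = ≤-reflexive (trans (∣p─q∣≡n∸∣p∩q∣ fX)
    (trans (cong (λ p → n ∸ ∣ p ∣) (∩-idem X)) (trans (cong (n ∸_) (pure fX)) (n∸n≡0 n))))
  walk⇒∣─∣≤ {X} {Z} (_◂_ {Y = Y} a w) = ≤-trans (∣p─r∣≤∣p─q∣+∣q─r∣ X Y Z)
    (+-mono-≤ (≤-reflexive (adjacent⇒∣─∣ a)) (walk⇒∣─∣≤ w))

  distance-unique : ∀ {X Y a b} → Distance Δ n X Y a → Distance Δ n X Y b → a ≡ b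
  distance-unique (p , a≤) (q , b≤) = ≤-antisym (a≤ q) (b≤ p)

  normal⇒∣─∣ : ∀ {X Y d} → Facet X → Distance Δ n X Y d → DistanceNormalPair Δ n X Y → ∣ X ─ Y ∣ ≡ d
  normal⇒∣─∣ fX dist (_ , dist′ , _ , eq) =
    trans (∣p─q∣≡n∸∣p∩q∣ fX) (trans (sym eq) (distance-unique dist′ dist))

  -- Distance normal geodesics are straight

  module _ {m} (P : Vector (Subset v) (suc m)) (geodesic : IsDistanceNormalGeodesic Δ n P) where

    private
      X : ℕ → Subset v
      X = P ∘ clamp m

      P-end : X m ≡ P (fromℕ m)
      P-end = cong P (trans (cong (clamp m) (sym (toℕ-fromℕ m))) (clamp-toℕ (fromℕ m)))

      distance : Distance Δ n (X 0) (X m) m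
      distance = subst (λ Y → Distance Δ n (X 0) Y m)
        (sym P-end) (proj₂ (proj₁ geodesic))

      facets : ∀ l → Facet (X l)
      facets l = proj₁ (proj₁ (proj₁ geodesic)) (clamp m l)

      segment : ∀ i d → i + d ≤ m → Walk (X i) (X (i + d)) d
      segment i zero    i+d≤m = subst (λ l → Walk (X i) (X l) 0) (sym (+-identityʳ i)) (stop (facets i))
      segment i (suc d) i+d≤m =
        clamp-step (Adjacent Δ n) P (proj₂ (proj₁ (proj₁ geodesic))) i (≤-trans (s≤s (m≤m+n i d)) i+d<m)
        ◂ subst (λ l → Walk (X (suc i)) (X l) d) (sym (+-suc i d)) (segment (suc i) d i+d<m)
        where
        i+d<m : suc (i + d) ≤ m
        i+d<m = ≤-trans (≤-reflexive (sym (+-suc i d))) i+d≤m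

      segment-to-end : ∀ {i} → i ≤ m → Walk (X i) (X m) (m ∸ i)
      segment-to-end {i} i≤m = subst (λ l → Walk (X i) (X l) (m ∸ i)) (m+[n∸m]≡n i≤m)
        (segment i (m ∸ i) (≤-reflexive (m+[n∸m]≡n i≤m)))

      -- Serves twice: with `l` the length of a rival path in the middle, and with `l` the number of
      -- vertices lost there.
      squeeze : ∀ {i d l} → i + d ≤ m → m ≤ i + (l + (m ∸ (i + d))) → d ≤ l
      squeeze {i} {d} {l} i+d≤m m≤ =
        +-cancelʳ-≤ (m ∸ (i + d)) d l (+-cancelˡ-≤ i (d + (m ∸ (i + d))) (l + (m ∸ (i + d))) (begin
        i + (d + (m ∸ (i + d)))  ≡⟨ +-assoc i d (m ∸ (i + d)) ⟨
        (i + d) + (m ∸ (i + d))  ≡⟨ m+[n∸m]≡n i+d≤m ⟩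
        m                        ≤⟨ m≤ ⟩
        i + (l + (m ∸ (i + d)))  ∎))
        where open ≤-Reasoning

      -- A shorter path between the two facets, spliced in between the outer segments, would shorten
      -- the geodesic itself.
      segment-distance : ∀ i d → i + d ≤ m → Distance Δ n (X i) (X (i + d)) d
      segment-distance i d i+d≤m = walk⇒path (segment i d i+d≤m) , λ path → squeeze i+d≤m
        (proj₂ distance (walk⇒path (segment 0 i (≤-trans (m≤m+n i d) i+d≤m)
          ◂◂ path⇒walk path ◂◂ segment-to-end i+d≤m)))

      -- The m vertices lost from end to end are at most the sum of the losses on the three parts,
      -- and each loss is at most the number of steps; so none can fall short.
      straight-short : m ≤ n → Straight X m
      straight-short m≤n i d i+d≤m _ = ≤-antisym (walk⇒∣─∣≤ (segment i d i+d≤m))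
        (squeeze i+d≤m (begin
        m
          ≡⟨ normal⇒∣─∣ (facets 0) (proj₂ (proj₁ geodesic)) (proj₁ (proj₂ geodesic) m≤n) ⟨
        ∣ P zero ─ P (fromℕ m) ∣
          ≡⟨ cong (λ p → ∣ X 0 ─ p ∣) P-end ⟨
        ∣ X 0 ─ X m ∣
          ≤⟨ ∣p─r∣≤∣p─q∣+∣q─r∣ (X 0) (X i) (X m) ⟩
        ∣ X 0 ─ X i ∣ + ∣ X i ─ X m ∣
          ≤⟨ +-monoʳ-≤ _ (∣p─r∣≤∣p─q∣+∣q─r∣ (X i) (X (i + d)) (X m)) ⟩
        ∣ X 0 ─ X i ∣ + (∣ X i ─ X (i + d) ∣ + ∣ X (i + d) ─ X m ∣)
          ≤⟨ +-mono-≤ (walk⇒∣─∣≤ to-i) (+-monoʳ-≤ _ (walk⇒∣─∣≤ (segment-to-end i+d≤m))) ⟩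
        i + (∣ X i ─ X (i + d) ∣ + (m ∸ (i + d)))
          ∎))
        where
        open ≤-Reasoning
        to-i : Walk (X 0) (X i) i
        to-i = segment 0 i (≤-trans (m≤m+n i d) i+d≤m)

      straight-long : n < m → Straight X m
      straight-long n<m i d i+d≤m d≤n = normal⇒∣─∣ (facets i) (segment-distance i d i+d≤m)
        (proj₂ (proj₂ geodesic) n<m (clamp m i) (clamp m (i + d)) (segment-distance i d i+d≤m) d≤n)

      straight : Straight X m
      straight with m ≤? n
      ... | yes m≤n = straight-short m≤n
      ... | no  m≰n = straight-long (≰⇒> m≰n)

      inShadow⇒through : ∀ Z → InShadow Δ n P Z → Through X m Z
      inShadow⇒through Z (j , eq) = j , λ i i≤m →
        trans (cong (λ i → shadow Δ n Z (j + i)) (sym (toℕ-clamp i≤m))) (eq (clamp m i))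

    inShadow-exists : ∃[ Z ] InShadow Δ n P Z
    inShadow-exists =
      let Z , eq = through-straight m X facets straight
      in Z , 0 , λ i → trans (eq (toℕ i) (toℕ≤pred[n] i)) (cong P (clamp-toℕ i))

    inShadow-atMost : AtMost Δ n ((n ∸ m) !) (InShadow Δ n P)
    inShadow-atMost =
      let S , follows = follows-straight m X facets straight
          Zs , len , complete = atMost-through m X S follows
      in Zs , len , λ Z → complete Z ∘ inShadow⇒through Z

    inShadow-unique : n < m → ExactlyOne Δ n (InShadow Δ n P)
    inShadow-unique n<m =
      let Z , inZ = inShadow-exists
          Zs , len , complete = inShadow-atMost
      in Z , inZ , λ W inW →
        -- Here `n ∸ m` is 0, so the list of representatives has at most one entry, with which both
        -- `W` and `Z` are identified.
        same (≤-trans len (≤-reflexive (cong _! (m≤n⇒m∸n≡0 (<⇒≤ n<m)))))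
          (complete W inW) (complete Z inZ)
      where
      same : ∀ {Zs Z W} → length Zs ≤ 1 → Any (_≈_ Δ n W) Zs → Any (_≈_ Δ n Z) Zs → _≈_ Δ n W Z
      same len (here W≈) (here Z≈) = transitive _ W≈ (symmetric _ Z≈)
      same {_ ∷ []} len (there ()) _
      same {_ ∷ []} len (here _) (there ())
      same {_ ∷ _ ∷ _} (s≤s ()) _ _

theorem1 : ∀ {v n : ℕ} .{{_ : NonZero n}} (Δ : SimplicialComplex v) →
    IsThinChamberComplex Δ n →
    ∀ {m : ℕ} (X : Vector (Subset v) (suc m)) →
    IsDistanceNormalGeodesic Δ n X →
    (∃[ Z ] InShadow Δ n X Z)
    × (m ≤ n → AtMost Δ n ((n ∸ m) !) (InShadow Δ n X))
    × (n < m → ExactlyOne Δ n (InShadow Δ n X))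
theorem1 {n = zero} {{nz}} = ⊥-elim-irr (≢-nonZero⁻¹ 0 {{nz}} refl)
theorem1 {n = suc k} Δ tcc X geodesic =
  inShadow-exists Δ pure thin X geodesic ,
  (λ _ → inShadow-atMost Δ pure thin X geodesic) ,
  inShadow-unique Δ pure thin X geodesic
  where open IsThinChamberComplex tcc
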